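{- Let $G$ be an $\widetilde{\mathfrak M}_c$-group and $H$ an almost solvable subgroup of $G$ of class $n$. Then there exists a definable solvable subgroup $D$ of $G$ of class at most $2n$ such that $H\cap D$ has finite index in $H$.
   Context: $G$ is a group, possibly with additional first-order structure ("definable" = definable with parameters). $G$ is an $\widetilde{\mathfrak M}_c$-group if for any two definable subgroups $K,N$ of $G$ with $N$ normalized by $K$ there are natural numbers $n_0,d$ such that every chain of centralizers $C_{K/N}(g_0N)\geq C_{K/N}(g_0N,g_1N)\geq\cdots$ ($g_i\in K$, centralizers in $K/(K\cap N)$) with each group of index at least $d$ in its predecessor has length at most $n_0$. A group is almost abelian if the centralizer of each of its elements has finite index in it. A group $H$ is almost solvable if there is a finite sequence of normal subgroups $H=H_0\trianglerighteq H_1\trianglerighteq\cdots\trianglerighteq H_n=\{1\}$ of $H$ with each $H_i/H_{i+1}$ almost abelian; the least such $n$ is the almost solvable class. -}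

module Defs where

open import Level using (0ℓ)
open import Algebra.Bundles using (Group)
open import Data.Nat using (ℕ; zero; suc; _<_; _≤_; _*_)
open import Data.Fin using (Fin)
open import Data.Vec using (Vec; []; _∷_; lookup)
open import Data.Vec.Relation.Binary.Pointwise.Inductive using (Pointwise)
open import Data.Product using (Σ; _×_; _,_; ∃)
open import Data.Sum using (_⊎_)
open import Data.Empty using (⊥)
open import Relation.Nullary using (¬_)
open import Relation.Binary.PropositionalEquality using (_≢_)

-- A group carrying additional first-order structure in a language
-- (Func k / Rel k = k-ary function / relation symbols, beyond the group
-- operations and equality, which are always available).

record FOGroup : Set₁ where
  field
    group : Group 0ℓ 0ℓ
  open Group group public
  field
    Func Rel : ℕ → Set
    funI : ∀ {k} → Func k → Vec Carrier k → Carrier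
    relI : ∀ {k} → Rel k → Vec Carrier k → Set
    funI-cong : ∀ {k} (f : Func k) {xs ys : Vec Carrier k} →
                Pointwise _≈_ xs ys → funI f xs ≈ funI f ys
    relI-resp : ∀ {k} (r : Rel k) {xs ys : Vec Carrier k} →
                Pointwise _≈_ xs ys → relI r xs → relI r ys

module _ (M : FOGroup) where
  open FOGroup M

  data Term (n : ℕ) : Set where
    var  : Fin n → Term n
    one  : Term n
    mul  : Term n → Term n → Term n
    inv  : Term n → Term n
    app  : ∀ {k} → Func k → Vec (Term n) k → Term n

  data Formula : ℕ → Set where
    eq   : ∀ {n} → Term n → Term n → Formula n
    rel  : ∀ {n k} → Rel k → Vec (Term n) k → Formula n
    fls  : ∀ {n} → Formula n
    and  : ∀ {n} → Formula n → Formula n → Formula n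
    or   : ∀ {n} → Formula n → Formula n → Formula n
    imp  : ∀ {n} → Formula n → Formula n → Formula n
    all  : ∀ {n} → Formula (suc n) → Formula n
    ex   : ∀ {n} → Formula (suc n) → Formula n

  mutual
    evalT : ∀ {n} → Vec Carrier n → Term n → Carrier
    evalT ρ (var i)   = lookup ρ i
    evalT ρ one       = ε
    evalT ρ (mul s t) = evalT ρ s ∙ evalT ρ t
    evalT ρ (inv t)   = evalT ρ t ⁻¹
    evalT ρ (app f ts) = funI f (evalTs ρ ts)

    evalTs : ∀ {n k} → Vec Carrier n → Vec (Term n) k → Vec Carrier k
    evalTs ρ []       = []
    evalTs ρ (t ∷ ts) = evalT ρ t ∷ evalTs ρ ts

  Sat : ∀ {n} → Formula n → Vec Carrier n → Set
  Sat (eq s t)    ρ = evalT ρ s ≈ evalT ρ t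
  Sat (rel r ts)  ρ = relI r (evalTs ρ ts)
  Sat fls         ρ = ⊥
  Sat (and φ ψ)   ρ = Sat φ ρ × Sat ψ ρ
  Sat (or φ ψ)    ρ = Sat φ ρ ⊎ Sat ψ ρ
  Sat (imp φ ψ)   ρ = Sat φ ρ → Sat ψ ρ
  Sat (all φ)     ρ = (a : Carrier) → Sat φ (a ∷ ρ)
  Sat (ex φ)      ρ = Σ Carrier λ a → Sat φ (a ∷ ρ)

  Definable : (Carrier → Set) → Set
  Definable P = Σ ℕ λ m → Σ (Formula (suc m)) λ φ → Σ (Vec Carrier m) λ ps →
                  (x : Carrier) → (P x → Sat φ (x ∷ ps)) × (Sat φ (x ∷ ps) → P x)

  record Subgroup : Set₁ where
    field
      P     : Carrier → Set
      resp  : ∀ {x y} → x ≈ y → P x → P y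
      ε∈    : P ε
      ∙∈    : ∀ {x y} → P x → P y → P (x ∙ y)
      ⁻¹∈   : ∀ {x} → P x → P (x ⁻¹)
  open Subgroup public

  [_,_] : Carrier → Carrier → Carrier
  [ x , y ] = x ⁻¹ ∙ y ⁻¹ ∙ x ∙ y

  -- A has finite index in B (A, B given as predicates; A ∩ B is meant)
  FiniteIndex : (Carrier → Set) → (Carrier → Set) → Set
  FiniteIndex A B = Σ ℕ λ m → Σ (Fin m → Carrier) λ r →
    (∀ i → B (r i)) × (∀ b → B b → ∃ λ i → A (r i ⁻¹ ∙ b))

  IndexAtLeast : ℕ → (Carrier → Set) → (Carrier → Set) → Set
  IndexAtLeast d A B = Σ (Fin d → Carrier) λ f →
    (∀ i → B (f i)) × (∀ i j → i ≢ j → ¬ A (f i ⁻¹ ∙ f j))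

  Normalizes : Subgroup → Subgroup → Set
  Normalizes K N = ∀ k x → P K k → P N x → P N (k ∙ x ∙ k ⁻¹)

  -- centralizer in K/(K∩N) of g 0 N, …, g (m-1) N (as subgroup of K)
  Cent : Subgroup → Subgroup → (ℕ → Carrier) → ℕ → Carrier → Set
  Cent K N g m x = P K x × (∀ i → i < m → P N [ x , g i ])

  -- the M̃c condition; chain C(g₀) ≥ C(g₀,g₁) ≥ … ≥ C(g₀,…,g_m), m steps
  M̃c : Set₁
  M̃c = (K N : Subgroup) → Definable (P K) → Definable (P N) → Normalizes K N →
    Σ ℕ λ n₀ → Σ ℕ λ d → (g : ℕ → Carrier) → (∀ i → P K (g i)) → (m : ℕ) →
      (∀ i → i < m → IndexAtLeast d (Cent K N g (suc (suc i))) (Cent K N g (suc i))) →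
      m ≤ n₀

  Series : (Subgroup → Subgroup → Set) → Subgroup → ℕ → Set₁
  Series Factor H n = Σ (ℕ → Subgroup) λ S →
    (∀ x → (P (S 0) x → P H x) × (P H x → P (S 0) x)) ×
    (∀ x → P (S n) x → x ≈ ε) ×
    (∀ i → i < n → (∀ x → P (S (suc i)) x → P (S i) x) ×
                   Normalizes H (S i) ×
                   Factor (S i) (S (suc i)))

  AlmostAbelianFactor : Subgroup → Subgroup → Set
  AlmostAbelianFactor A B =
    ∀ h → P A h → FiniteIndex (λ x → P A x × P B [ x , h ]) (P A)

  AbelianFactor : Subgroup → Subgroup → Set
  AbelianFactor A B = ∀ x y → P A x → P A y → P B [ x , y ]

  AlmostSolvableClass : Subgroup → ℕ → Set₁
  AlmostSolvableClass H n = Series AlmostAbelianFactor H n ×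
    (∀ m → Series AlmostAbelianFactor H m → n ≤ m)

  SolvableClassAtMost : Subgroup → ℕ → Set₁
  SolvableClassAtMost D k = Σ ℕ λ k' → k' ≤ k × Series AbelianFactor D k'

{-# OPTIONS --safe #-}
module Submission where

open import Defs
open import Level using (0ℓ)
open import Axiom.ExcludedMiddle using (ExcludedMiddle)
open import Algebra.Bundles using (Group)
import Algebra.Properties.Group as GroupProperties
open import Data.Bool using (Bool; true; false; not)
open import Data.Empty using (⊥; ⊥-elim)
open import Data.Fin using (Fin; zero; suc; _↑ˡ_; _↑ʳ_; combine; remQuot; punchIn; punchOut)
open import Data.Fin.Properties using (_≟_; pigeonhole; remQuot-combine; punchInᵢ≢i; punchIn-punchOut; <⇒≢)
open import Data.List using (List; []; _∷_; _++_; foldr; length; cartesianProductWith)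
import Data.List as List
open import Data.List.Relation.Unary.Any using (Any; here; there; index)
import Data.List.Relation.Unary.Any as Any
open import Data.List.Relation.Unary.Any.Properties using (++⁺ˡ; ++⁺ʳ; map⁺; lookup-index)
open import Data.Nat using (ℕ; zero; suc; _+_; _*_; _<_; _≤_; s≤s)
open import Data.Nat.Properties using (≤-refl; <-irrefl; <⇒≤; m≤n⇒m≤1+n; m≤n⇒m<n∨m≡n; n<1+n; *-comm; ≤-reflexive)
open import Data.Product using (Σ; _×_; _,_; proj₁; proj₂; ∃; ∃-syntax)
open import Data.Sum using (_⊎_; inj₁; inj₂)
open import Data.Unit using (⊤; tt)
open import Data.Vec using (Vec; []; _∷_; lookup; tabulate; map)
import Data.Vec as Vec
open import Data.Vec.Properties using (lookup∘tabulate; lookup-++ˡ; lookup-++ʳ; lookup-map)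
open import Function using (_∘_; id)
open import Relation.Binary.PropositionalEquality using (_≡_; _≢_; cong; cong₂; subst; subst₂)
import Relation.Binary.PropositionalEquality as ≡
import Relation.Binary.Reasoning.Setoid as SetoidReasoning
import Relation.Binary.Reflection as Reflection
open import Relation.Nullary using (¬_; yes; no)

-- Work from the bottom of the almost abelian series, always modulo a definable N that already almost contains
-- the lower terms. For an almost abelian group A, the chain condition gives a centralizer E of finitely many
-- elements of A that is almost centralized by every element of A. Its FC-centralizer Z contains A and depends on E
-- only up to commensurability, hence is normalized with A; so is the FC-centre V of Z, in which conjugacy
-- classes are bounded. Neumann's covering lemma shows that V almost contains A, and his argument on a largest
-- class shows that V has finitely many commutators. Their centralizer B in V is definable, has finite index in
-- V, is nilpotent of class two and is normalized by H. Continue inside the normalizer of B, modulo B: every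
-- almost abelian factor costs two abelian ones.

-- Two obstacles shape the proof: H and A are not definable, and finite index is not a first-order
-- condition. The chain condition meets both. If the elements of a set all have centralizers of
-- finite index in X, finitely many of them already cut X down to a subgroup of finite index in
-- which every other one of these centralizers has index at most the constant `d`. So finiteness
-- implies a uniform bound, and a single formula describes `FC X` once X is definable.
--
-- Z alone is not enough: its elements have boundedly many conjugates under E, not under Z. In
-- `V = Z ⊓ FC Z` the bound becomes internal, but A might be lost on the way; the covering lemma
-- turns the bound for E-conjugates of elements of Z into a bound for the index of `FC Z` in
-- `A ⊓ E`.
--
-- The final subgroup is known only after the last stage, yet it has to normalize the terms produced
-- at every stage. It is therefore kept inside the normalizers of all the groups B.

infix 1 _⟺_
_⟺_ : Set → Set → Set
A ⟺ B = (A → B) × (B → A)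

-- Decides identities that hold in every group by comparing reduced words.
module GroupSolver {c ℓ} (G : Group c ℓ) where
  open Group G
  open GroupProperties G using (⁻¹-anti-homo-∙; ε⁻¹≈ε; ⁻¹-involutive)
  open SetoidReasoning setoid

  infixl 7 _⊙_
  infix  8 _⁻

  data Expr (n : ℕ) : Set where
    var : Fin n → Expr n
    e   : Expr n
    _⊙_ : Expr n → Expr n → Expr n
    _⁻  : Expr n → Expr n

  Word : ℕ → Set
  Word n = List (Bool × Fin n)

  ⟦_⟧ : ∀ {n} → Expr n → Vec Carrier n → Carrier
  ⟦ var i ⟧ ρ = lookup ρ i
  ⟦ e ⟧     ρ = ε
  ⟦ s ⊙ t ⟧ ρ = ⟦ s ⟧ ρ ∙ ⟦ t ⟧ ρ
  ⟦ t ⁻ ⟧   ρ = ⟦ t ⟧ ρ ⁻¹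

  letter : ∀ {n} → Vec Carrier n → Bool × Fin n → Carrier
  letter ρ (true  , i) = lookup ρ i
  letter ρ (false , i) = lookup ρ i ⁻¹

  word : ∀ {n} → Vec Carrier n → Word n → Carrier
  word ρ = foldr (λ l x → letter ρ l ∙ x) ε

  push : ∀ {n} → Bool × Fin n → Word n → Word n
  push l [] = l ∷ []
  push (true  , i) ((false , j) ∷ w) with i ≟ j
  ... | yes _ = w
  ... | no  _ = (true , i) ∷ (false , j) ∷ w
  push (false , i) ((true  , j) ∷ w) with i ≟ j
  ... | yes _ = w
  ... | no  _ = (false , i) ∷ (true , j) ∷ w
  push l (l′ ∷ w) = l ∷ l′ ∷ w

  append : ∀ {n} → Word n → Word n → Word n
  append v w = foldr push w v

  invert : ∀ {n} → Word n → Word n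
  invert []            = []
  invert ((b , i) ∷ w) = append (invert w) ((not b , i) ∷ [])

  normal : ∀ {n} → Expr n → Word n
  normal (var i) = (true , i) ∷ []
  normal e       = []
  normal (s ⊙ t) = append (normal s) (normal t)
  normal (t ⁻)   = invert (normal t)

  push-correct : ∀ {n} (ρ : Vec Carrier n) l w → word ρ (push l w) ≈ letter ρ l ∙ word ρ w
  push-correct ρ l [] = refl
  push-correct ρ (true  , i) ((true  , j) ∷ w) = refl
  push-correct ρ (false , i) ((false , j) ∷ w) = refl
  push-correct ρ (true  , i) ((false , j) ∷ w) with i ≟ j
  ... | no  _      = refl
  ... | yes ≡.refl = begin
    word ρ w                                     ≈⟨ identityˡ _ ⟨
    ε ∙ word ρ w                                 ≈⟨ ∙-congʳ (inverseʳ _) ⟨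
    lookup ρ i ∙ lookup ρ i ⁻¹ ∙ word ρ w        ≈⟨ assoc _ _ _ ⟩
    lookup ρ i ∙ (lookup ρ i ⁻¹ ∙ word ρ w)      ∎
  push-correct ρ (false , i) ((true  , j) ∷ w) with i ≟ j
  ... | no  _      = refl
  ... | yes ≡.refl = begin
    word ρ w                                     ≈⟨ identityˡ _ ⟨
    ε ∙ word ρ w                                 ≈⟨ ∙-congʳ (inverseˡ _) ⟨
    lookup ρ i ⁻¹ ∙ lookup ρ i ∙ word ρ w        ≈⟨ assoc _ _ _ ⟩
    lookup ρ i ⁻¹ ∙ (lookup ρ i ∙ word ρ w)      ∎

  append-correct : ∀ {n} (ρ : Vec Carrier n) v w → word ρ (append v w) ≈ word ρ v ∙ word ρ w
  append-correct ρ []      w = sym (identityˡ _)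
  append-correct ρ (l ∷ v) w = begin
    word ρ (push l (append v w))        ≈⟨ push-correct ρ l (append v w) ⟩
    letter ρ l ∙ word ρ (append v w)    ≈⟨ ∙-congˡ (append-correct ρ v w) ⟩
    letter ρ l ∙ (word ρ v ∙ word ρ w)  ≈⟨ assoc _ _ _ ⟨
    letter ρ l ∙ word ρ v ∙ word ρ w    ∎

  letter-inverse : ∀ {n} (ρ : Vec Carrier n) b i → letter ρ (not b , i) ≈ letter ρ (b , i) ⁻¹
  letter-inverse ρ true  i = refl
  letter-inverse ρ false i = sym (⁻¹-involutive _)

  invert-correct : ∀ {n} (ρ : Vec Carrier n) w → word ρ (invert w) ≈ word ρ w ⁻¹
  invert-correct ρ []            = sym ε⁻¹≈ε
  invert-correct ρ ((b , i) ∷ w) = begin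
    word ρ (append (invert w) ((not b , i) ∷ []))       ≈⟨ append-correct ρ (invert w) _ ⟩
    word ρ (invert w) ∙ (letter ρ (not b , i) ∙ ε)      ≈⟨ ∙-cong (invert-correct ρ w) (identityʳ _) ⟩
    word ρ w ⁻¹ ∙ letter ρ (not b , i)                  ≈⟨ ∙-congˡ (letter-inverse ρ b i) ⟩
    word ρ w ⁻¹ ∙ letter ρ (b , i) ⁻¹                   ≈⟨ ⁻¹-anti-homo-∙ _ _ ⟨
    (letter ρ (b , i) ∙ word ρ w) ⁻¹                    ∎

  normal-correct : ∀ {n} (t : Expr n) (ρ : Vec Carrier n) → word ρ (normal t) ≈ ⟦ t ⟧ ρ
  normal-correct (var i) ρ = identityʳ _
  normal-correct e       ρ = refl
  normal-correct (s ⊙ t) ρ =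
    trans (append-correct ρ (normal s) (normal t)) (∙-cong (normal-correct s ρ) (normal-correct t ρ))
  normal-correct (t ⁻)   ρ = trans (invert-correct ρ (normal t)) (⁻¹-cong (normal-correct t ρ))

  open Reflection setoid var ⟦_⟧ (λ t ρ → word ρ (normal t)) normal-correct public
    using (solve; _⊜_)

-- Substitution, parameters and finite connectives in formulas.

module Definability (M : FOGroup) where
  open FOGroup M

  mutual
    subT : ∀ {n k} → (Fin n → Term M k) → Term M n → Term M k
    subT σ (var i)    = σ i
    subT σ one        = one
    subT σ (mul s t)  = mul (subT σ s) (subT σ t)
    subT σ (inv t)    = inv (subT σ t)
    subT σ (app f ts) = app f (subTs σ ts)

    subTs : ∀ {n k m} → (Fin n → Term M k) → Vec (Term M n) m → Vec (Term M k) m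
    subTs σ []       = []
    subTs σ (t ∷ ts) = subT σ t ∷ subTs σ ts

  lift : ∀ {n k} → (Fin n → Term M k) → Fin (suc n) → Term M (suc k)
  lift σ zero    = var zero
  lift σ (suc i) = subT (var ∘ suc) (σ i)

  sub : ∀ {n k} → (Fin n → Term M k) → Formula M n → Formula M k
  sub σ (eq s t)   = eq (subT σ s) (subT σ t)
  sub σ (rel r ts) = rel r (subTs σ ts)
  sub σ fls        = fls
  sub σ (and φ ψ)  = and (sub σ φ) (sub σ ψ)
  sub σ (or φ ψ)   = or (sub σ φ) (sub σ ψ)
  sub σ (imp φ ψ)  = imp (sub σ φ) (sub σ ψ)
  sub σ (all φ)    = all (sub (lift σ) φ)
  sub σ (ex φ)     = ex (sub (lift σ) φ)

  _⊢_▷_ : ∀ {n k} → Vec Carrier k → (Fin n → Term M k) → Vec Carrier n → Set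
  ρ′ ⊢ σ ▷ ρ = ∀ i → lookup ρ i ≡ evalT M ρ′ (σ i)

  mutual
    evalT-sub : ∀ {n k} {ρ : Vec Carrier n} {ρ′ : Vec Carrier k} {σ} → ρ′ ⊢ σ ▷ ρ →
                ∀ t → evalT M ρ t ≡ evalT M ρ′ (subT σ t)
    evalT-sub r (var i)    = r i
    evalT-sub r one        = ≡.refl
    evalT-sub r (mul s t)  = cong₂ _∙_ (evalT-sub r s) (evalT-sub r t)
    evalT-sub r (inv t)    = cong _⁻¹ (evalT-sub r t)
    evalT-sub r (app f ts) = cong (funI f) (evalTs-sub r ts)

    evalTs-sub : ∀ {n k m} {ρ : Vec Carrier n} {ρ′ : Vec Carrier k} {σ} → ρ′ ⊢ σ ▷ ρ →
                 (ts : Vec (Term M n) m) → evalTs M ρ ts ≡ evalTs M ρ′ (subTs σ ts)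
    evalTs-sub r []       = ≡.refl
    evalTs-sub r (t ∷ ts) = cong₂ _∷_ (evalT-sub r t) (evalTs-sub r ts)

  lift-▷ : ∀ {n k} {ρ : Vec Carrier n} {ρ′ : Vec Carrier k} {σ} → ρ′ ⊢ σ ▷ ρ →
           ∀ a → (a ∷ ρ′) ⊢ lift σ ▷ (a ∷ ρ)
  lift-▷ r a zero    = ≡.refl
  lift-▷ {σ = σ} r a (suc i) = ≡.trans (r i) (evalT-sub (λ _ → ≡.refl) (σ i))

  Sat-sub : ∀ {n k} {ρ : Vec Carrier n} {ρ′ : Vec Carrier k} {σ} → ρ′ ⊢ σ ▷ ρ →
            ∀ φ → Sat M φ ρ ⟺ Sat M (sub σ φ) ρ′
  Sat-sub r (eq s t)   = subst₂ _≈_ (evalT-sub r s) (evalT-sub r t) ,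
                         subst₂ _≈_ (≡.sym (evalT-sub r s)) (≡.sym (evalT-sub r t))
  Sat-sub r (rel R ts) = subst (relI R) (evalTs-sub r ts) , subst (relI R) (≡.sym (evalTs-sub r ts))
  Sat-sub r fls        = id , id
  Sat-sub r (and φ ψ)  =
    let (f , f′) = Sat-sub r φ; (g , g′) = Sat-sub r ψ
    in (λ (p , q) → f p , g q) , (λ (p , q) → f′ p , g′ q)
  Sat-sub r (or φ ψ)   =
    let (f , f′) = Sat-sub r φ; (g , g′) = Sat-sub r ψ
    in (λ { (inj₁ p) → inj₁ (f p) ; (inj₂ q) → inj₂ (g q) }) ,
       (λ { (inj₁ p) → inj₁ (f′ p) ; (inj₂ q) → inj₂ (g′ q) })
  Sat-sub r (imp φ ψ)  =
    let (f , f′) = Sat-sub r φ; (g , g′) = Sat-sub r ψ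
    in (λ h → g ∘ h ∘ f′) , (λ h → g′ ∘ h ∘ f)
  Sat-sub r (all φ)    = (λ h a → proj₁ (Sat-sub (lift-▷ r a) φ) (h a)) ,
                         (λ h a → proj₂ (Sat-sub (lift-▷ r a) φ) (h a))
  Sat-sub r (ex φ)     = (λ (a , p) → a , proj₁ (Sat-sub (lift-▷ r a) φ) p) ,
                         (λ (a , p) → a , proj₂ (Sat-sub (lift-▷ r a) φ) p)

  -- The parameters are fixed in the type, so that sets defined from the same tuple combine without
  -- merging parameter lists; all subgroups of one envelope are defined from the tuple `as`.
  DefinableFrom : ∀ {m} → Vec Carrier m → (Carrier → Set) → Set
  DefinableFrom {m} ps X = Σ (Formula M (suc m)) λ φ → (x : Carrier) → X x ⟺ Sat M φ (x ∷ ps)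

  replacing : ∀ {m n} → Term M n → (Fin m → Fin n) → Fin (suc m) → Term M n
  replacing t ι zero    = t
  replacing t ι (suc k) = var (ι k)

  -- Moves a definition into a larger context: `t` replaces the defined variable and `ι` says where
  -- the parameters now stand.
  instantiate : ∀ {m n} → Formula M (suc m) → Term M n → (Fin m → Fin n) → Formula M n
  instantiate φ t ι = sub (replacing t ι) φ

  Sat-instantiate : ∀ {m n} {ps : Vec Carrier m} {X} ((φ , _) : DefinableFrom ps X) (t : Term M n) ι
                    (ρ : Vec Carrier n) → (∀ k → lookup ps k ≡ lookup ρ (ι k)) →
                    X (evalT M ρ t) ⟺ Sat M (instantiate φ t ι) ρ
  Sat-instantiate {ps = ps} (φ , φ-def) t ι ρ agree =
    let (f , g) = Sat-sub {ρ = evalT M ρ t ∷ ps} {ρ′ = ρ} {σ = replacing t ι}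
                    (λ { zero → ≡.refl ; (suc k) → agree k }) φ
    in f ∘ proj₁ (φ-def _) , proj₂ (φ-def _) ∘ g

  ⋀ ⋁ : ∀ {m n} → (Fin m → Formula M n) → Formula M n
  ⋀ {zero}  φ = imp fls fls
  ⋀ {suc m} φ = and (φ zero) (⋀ (φ ∘ suc))
  ⋁ {zero}  φ = fls
  ⋁ {suc m} φ = or (φ zero) (⋁ (φ ∘ suc))

  Sat-⋀ : ∀ {m n} (φ : Fin m → Formula M n) ρ → (∀ i → Sat M (φ i) ρ) ⟺ Sat M (⋀ φ) ρ
  Sat-⋀ {zero}  φ ρ = (λ _ → id) , λ _ ()
  Sat-⋀ {suc m} φ ρ =
    let (f , g) = Sat-⋀ (φ ∘ suc) ρ
    in (λ h → h zero , f (h ∘ suc)) , λ { (p , q) zero → p ; (p , q) (suc i) → g q i }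

  Sat-⋁ : ∀ {m n} (φ : Fin m → Formula M n) ρ → (∃[ i ] Sat M (φ i) ρ) ⟺ Sat M (⋁ φ) ρ
  Sat-⋁ {zero}  φ ρ = (λ ()) , (λ ())
  Sat-⋁ {suc m} φ ρ =
    let (f , g) = Sat-⋁ (φ ∘ suc) ρ
    in (λ { (zero , p) → inj₁ p ; (suc i , p) → inj₂ (f (i , p)) }) ,
       (λ { (inj₁ p) → zero , p ; (inj₂ q) → let (i , p) = g q in suc i , p })

  exs : ∀ m {n} → Formula M (m + n) → Formula M n
  exs zero    φ = φ
  exs (suc m) φ = exs m (ex φ)

  Sat-exs : ∀ m {n} (φ : Formula M (m + n)) ρ →
            (Σ (Vec Carrier m) λ ys → Sat M φ (ys Vec.++ ρ)) ⟺ Sat M (exs m φ) ρ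
  Sat-exs zero    φ ρ = (λ { ([] , p) → p }) , (λ p → [] , p)
  Sat-exs (suc m) φ ρ =
    let (f , g) = Sat-exs m (ex φ) ρ
    in (λ { (a ∷ ys , p) → f (ys , a , p) }) , (λ s → let (ys , a , p) = g s in a ∷ ys , p)

module GroupTheory (em : ExcludedMiddle 0ℓ) (Q : FOGroup) where
  open FOGroup Q
  open GroupProperties group using (∙-cancelˡ)
  open SetoidReasoning setoid
  open GroupSolver group using (solve; _⊜_; _⊙_; _⁻; e)

  module _ (A : Subgroup Q) where
    quotient-flip : ∀ {x y} → P A (x ⁻¹ ∙ y) → P A (y ⁻¹ ∙ x)
    quotient-flip {x} {y} p = resp A (solve 2 (λ x y → (x ⁻ ⊙ y) ⁻ ⊜ y ⁻ ⊙ x) refl x y) (⁻¹∈ A p)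

    same-coset : ∀ r {x y} → P A (r ⁻¹ ∙ x) → P A (r ⁻¹ ∙ y) → P A (x ⁻¹ ∙ y)
    same-coset r {x} {y} p q =
      resp A (solve 3 (λ r x y → (r ⁻ ⊙ x) ⁻ ⊙ (r ⁻ ⊙ y) ⊜ x ⁻ ⊙ y) refl r x y) (∙∈ A (⁻¹∈ A p) q)

    quotient∈ : ∀ {x y} → P A x → P A y → P A (x ⁻¹ ∙ y)
    quotient∈ p q = ∙∈ A (⁻¹∈ A p) q

    commutator∈ : ∀ {x y} → P A x → P A y → P A ([_,_] Q x y)
    commutator∈ p q = ∙∈ A (∙∈ A (∙∈ A (⁻¹∈ A p) (⁻¹∈ A q)) p) q

  -- Commuting elements and their centralizers.

  infix 4 _commutes_
  _commutes_ : Carrier → Carrier → Set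
  x commutes y = x ∙ y ≈ y ∙ x

  commutes-sym : ∀ {x y} → x commutes y → y commutes x
  commutes-sym = sym

  commutes-resp : ∀ {x y z} → y ≈ z → x commutes y → x commutes z
  commutes-resp {x} y≈z p = trans (∙-congˡ (sym y≈z)) (trans p (∙-congʳ y≈z))

  C : Carrier → Subgroup Q
  C x = record
    { P    = _commutes x
    ; resp = λ y≈z p → commutes-sym (commutes-resp y≈z (commutes-sym p))
    ; ε∈   = trans (identityˡ x) (sym (identityʳ x))
    ; ∙∈   = λ {y} {z} p q → begin
        y ∙ z ∙ x    ≈⟨ assoc y z x ⟩
        y ∙ (z ∙ x)  ≈⟨ ∙-congˡ q ⟩
        y ∙ (x ∙ z)  ≈⟨ assoc y x z ⟨
        y ∙ x ∙ z    ≈⟨ ∙-congʳ p ⟩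
        x ∙ y ∙ z    ≈⟨ assoc x y z ⟩
        x ∙ (y ∙ z)  ∎
    ; ⁻¹∈  = λ {y} p → begin
        y ⁻¹ ∙ x                ≈⟨ solve 2 (λ x y → y ⁻ ⊙ x ⊜ y ⁻ ⊙ (x ⊙ y) ⊙ y ⁻) refl x y ⟩
        y ⁻¹ ∙ (x ∙ y) ∙ y ⁻¹   ≈⟨ ∙-congʳ (∙-congˡ p) ⟨
        y ⁻¹ ∙ (y ∙ x) ∙ y ⁻¹   ≈⟨ solve 2 (λ x y → y ⁻ ⊙ (y ⊙ x) ⊙ y ⁻ ⊜ x ⊙ y ⁻) refl x y ⟩
        x ∙ y ⁻¹                ∎
    }

  commutator-ε⟺ : ∀ x y → ([_,_] Q x y ≈ ε) ⟺ x commutes y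
  commutator-ε⟺ x y =
    (λ p → begin
      x ∙ y                        ≈⟨ solve 2 (λ x y → x ⊙ y ⊜ y ⊙ x ⊙ (x ⁻ ⊙ y ⁻ ⊙ x ⊙ y)) refl x y ⟩
      y ∙ x ∙ [_,_] Q x y          ≈⟨ ∙-congˡ p ⟩
      y ∙ x ∙ ε                    ≈⟨ identityʳ _ ⟩
      y ∙ x                        ∎) ,
    (λ p → begin
      [_,_] Q x y                  ≈⟨ solve 2 (λ x y → x ⁻ ⊙ y ⁻ ⊙ x ⊙ y ⊜ (y ⊙ x) ⁻ ⊙ (x ⊙ y)) refl x y ⟩
      (y ∙ x) ⁻¹ ∙ (x ∙ y)         ≈⟨ ∙-congˡ p ⟩
      (y ∙ x) ⁻¹ ∙ (y ∙ x)         ≈⟨ inverseˡ _ ⟩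
      ε                            ∎)

  infixr 6 _⊓_
  _⊓_ : Subgroup Q → Subgroup Q → Subgroup Q
  A ⊓ B = record
    { P    = λ x → P A x × P B x
    ; resp = λ x≈y (p , q) → resp A x≈y p , resp B x≈y q
    ; ε∈   = ε∈ A , ε∈ B
    ; ∙∈   = λ (p , q) (p′ , q′) → ∙∈ A p p′ , ∙∈ B q q′
    ; ⁻¹∈  = λ (p , q) → ⁻¹∈ A p , ⁻¹∈ B q
    }

  CV : ∀ {m} → Vec Carrier m → Subgroup Q
  CV {m} as = record
    { P    = λ x → (i : Fin m) → x commutes lookup as i
    ; resp = λ x≈y p i → resp (C (lookup as i)) x≈y (p i)
    ; ε∈   = λ i → ε∈ (C (lookup as i))
    ; ∙∈   = λ p q i → ∙∈ (C (lookup as i)) (p i) (q i)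
    ; ⁻¹∈  = λ p i → ⁻¹∈ (C (lookup as i)) (p i)
    }

  -- Index, counted from above by representatives and from below by separated elements.

  IndexAtMost : ℕ → (Carrier → Set) → (Carrier → Set) → Set
  IndexAtMost m A B = Σ (Fin m → Carrier) λ r →
    (∀ i → B (r i)) × (∀ b → B b → ∃ λ i → A (r i ⁻¹ ∙ b))

  Separated : ∀ {d} → (Carrier → Set) → (Carrier → Set) → (Fin d → Carrier) → Set
  Separated A B f = (∀ i → B (f i)) × (∀ i j → i ≢ j → ¬ A (f i ⁻¹ ∙ f j))

  by-contradiction : {X : Set} → ¬ ¬ X → X
  by-contradiction {X} ¬¬x with em {X}
  ... | yes x  = x
  ... | no  ¬x = ⊥-elim (¬¬x ¬x)

  module _ (A B : Subgroup Q) where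
    -- An element missed by all the cosets lengthens the family. Hence a family of the largest
    -- possible size covers, which is how Neumann's argument finds all conjugates.
    covers-or-extends : ∀ {d} (f : Fin d → Carrier) → Separated (P A) (P B) f →
      (∀ b → P B b → ∃ λ i → P A (f i ⁻¹ ∙ b)) ⊎ IndexAtLeast Q (suc d) (P A) (P B)
    covers-or-extends {d} f (fB , sep) with em {Σ Carrier λ b → P B b × ∀ i → ¬ P A (f i ⁻¹ ∙ b)}
    ... | no  none          = inj₁ λ b Bb → by-contradiction λ ¬i → none (b , Bb , λ i p → ¬i (i , p))
    ... | yes (b , Bb , new) = inj₂ (f′ , f′B , sep′)
      where
      f′ : Fin (suc d) → Carrier
      f′ zero    = b
      f′ (suc i) = f i
      f′B : ∀ i → P B (f′ i)
      f′B zero    = Bb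
      f′B (suc i) = fB i
      sep′ : ∀ i j → i ≢ j → ¬ P A (f′ i ⁻¹ ∙ f′ j)
      sep′ zero    zero    i≢j = ⊥-elim (i≢j ≡.refl)
      sep′ zero    (suc j) i≢j = new j ∘ quotient-flip A
      sep′ (suc i) zero    i≢j = new i
      sep′ (suc i) (suc j) i≢j = sep i j (i≢j ∘ cong suc)

    pad : ∀ {m} → IndexAtMost m (P A) (P B) → IndexAtMost (suc m) (P A) (P B)
    pad (r , rB , cov) =
      (λ { zero → ε ; (suc i) → r i }) , (λ { zero → ε∈ B ; (suc i) → rB i }) ,
      λ b Bb → let (i , p) = cov b Bb in suc i , p

    -- The alternatives overlap: coverings are padded with a redundant representative, since only
    -- upper bounds matter.
    atLeast-or-atMost : ∀ d → IndexAtLeast Q d (P A) (P B) ⊎ IndexAtMost d (P A) (P B)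
    atLeast-or-atMost zero    = inj₁ ((λ ()) , (λ ()) , (λ ()))
    atLeast-or-atMost (suc d) with atLeast-or-atMost d
    ... | inj₂ cov = inj₂ (pad cov)
    ... | inj₁ (f , sep) with covers-or-extends f sep
    ...   | inj₂ sep′ = inj₁ sep′
    ...   | inj₁ cov  = inj₂ (pad (f , proj₁ sep , cov))

    ¬atLeast⇒atMost : ∀ d → ¬ IndexAtLeast Q d (P A) (P B) → IndexAtMost d (P A) (P B)
    ¬atLeast⇒atMost d ¬sep with atLeast-or-atMost d
    ... | inj₁ sep = ⊥-elim (¬sep sep)
    ... | inj₂ cov = cov

    atMost⇒¬atLeast : ∀ {m} → IndexAtMost m (P A) (P B) → ¬ IndexAtLeast Q (suc m) (P A) (P B)
    atMost⇒¬atLeast (r , _ , cov) (f , fB , sep) =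
      let label i = proj₁ (cov (f i) (fB i))
          (i , j , i<j , same) = pigeonhole (n<1+n _) label
      in sep i j (<⇒≢ i<j)
           (same-coset A (r (label i)) (proj₂ (cov (f i) (fB i)))
             (subst (λ k → P A (r k ⁻¹ ∙ f j)) (≡.sym same) (proj₂ (cov (f j) (fB j)))))

  -- The labels need not come from elements of B: representatives inside B are chosen classically.
  atMost-by-labels : ∀ A (B : Subgroup Q) {m} (R : Fin m → Carrier → Set) →
    (∀ b → P B b → ∃ λ i → R i b) →
    (∀ i x y → P B x → P B y → R i x → R i y → A (x ⁻¹ ∙ y)) →
    IndexAtMost m A (P B)
  atMost-by-labels A B {m} R labelled same =
      (λ i → proj₁ (rep i)) , (λ i → proj₁ (proj₂ (rep i))) ,
      λ b Bb → let (i , Rib) = labelled b Bb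
                   (r , Br , Rir) = rep i
               in i , same i r b Br Bb (Rir (b , Bb , Rib)) Rib
    where
    rep : ∀ i → Σ Carrier λ r → P B r × ((Σ Carrier λ b → P B b × R i b) → R i r)
    rep i with em {Σ Carrier λ b → P B b × R i b}
    ... | yes (b , Bb , Rib) = b , Bb , λ _ → Rib
    ... | no  none           = ε , ε∈ B , λ s → ⊥-elim (none s)

  atMost-by-labels₂ : ∀ A (B : Subgroup Q) {m n} (R : Fin m → Fin n → Carrier → Set) →
    (∀ b → P B b → ∃ λ i → ∃ λ j → R i j b) →
    (∀ i j x y → P B x → P B y → R i j x → R i j y → A (x ⁻¹ ∙ y)) →
    IndexAtMost (m * n) A (P B)
  atMost-by-labels₂ A B {m} {n} R labelled same =
    atMost-by-labels A B (λ k → let (i , j) = remQuot {m} n k in R i j)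
      (λ b Bb → let (i , j , p) = labelled b Bb
                in combine i j , subst (λ (i , j) → R i j b) (≡.sym (remQuot-combine i j)) p)
      (λ k x y → let (i , j) = remQuot {m} n k in same i j x y)

  atMost-mono : ∀ {m} A A′ (B : Subgroup Q) → (∀ x → P B x → A x → A′ x) →
                IndexAtMost m A (P B) → IndexAtMost m A′ (P B)
  atMost-mono A A′ B A⊆A′ (r , rB , cov) =
    r , rB , λ b Bb → let (i , p) = cov b Bb in i , A⊆A′ _ (quotient∈ B (rB i) Bb) p

  finite-mono : ∀ A A′ (B : Subgroup Q) → (∀ x → P B x → A x → A′ x) →
                FiniteIndex Q A (P B) → FiniteIndex Q A′ (P B)
  finite-mono A A′ B A⊆A′ (m , c) = m , atMost-mono A A′ B A⊆A′ c

  atMost-restrict : ∀ {m} (A B X : Subgroup Q) → (∀ x → P X x → P B x) →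
                    IndexAtMost m (P A) (P B) → IndexAtMost m (P A) (P X)
  atMost-restrict A B X X⊆B (r , _ , cov) =
    atMost-by-labels (P A) X (λ i x → P A (r i ⁻¹ ∙ x)) (λ b Xb → cov b (X⊆B b Xb))
      (λ i x y _ _ → same-coset A (r i))

  finite-⊓ : ∀ (A A′ B : Subgroup Q) → FiniteIndex Q (P A) (P B) → FiniteIndex Q (P A′) (P B) →
             FiniteIndex Q (P (A ⊓ A′)) (P B)
  finite-⊓ A A′ B (m , r , _ , cov) (m′ , r′ , _ , cov′) =
    m * m′ , atMost-by-labels₂ (P (A ⊓ A′)) B (λ i j x → P A (r i ⁻¹ ∙ x) × P A′ (r′ j ⁻¹ ∙ x))
      (λ b Bb → let (i , p) = cov b Bb; (j , q) = cov′ b Bb in i , j , p , q)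
      (λ { i j x y _ _ (p , q) (p′ , q′) → same-coset A (r i) p p′ , same-coset A′ (r′ j) q q′ })

  finite-⋂ : ∀ {k} (A : Fin k → Subgroup Q) (B : Subgroup Q) → (∀ i → FiniteIndex Q (P (A i)) (P B)) →
             FiniteIndex Q (λ x → ∀ i → P (A i) x) (P B)
  finite-⋂ {zero}  A B fin = 1 , (λ _ → ε) , (λ _ → ε∈ B) , λ _ _ → zero , λ ()
  finite-⋂ {suc k} A B fin =
    finite-mono (P (A zero ⊓ rest)) (λ x → ∀ i → P (A i) x) B (λ { x _ (p , q) zero → p ; x _ (p , q) (suc i) → q i })
      (finite-⊓ (A zero) rest B (fin zero) (finite-⋂ (A ∘ suc) B (fin ∘ suc)))
    where
    rest : Subgroup Q
    rest = record
      { P    = λ x → ∀ i → P (A (suc i)) x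
      ; resp = λ x≈y p i → resp (A (suc i)) x≈y (p i)
      ; ε∈   = λ i → ε∈ (A (suc i))
      ; ∙∈   = λ p q i → ∙∈ (A (suc i)) (p i) (q i)
      ; ⁻¹∈  = λ p i → ⁻¹∈ (A (suc i)) (p i)
      }

  atMost-trans : ∀ {m n} (A B X : Subgroup Q) →
                 IndexAtMost m (P A) (P B) → IndexAtMost n (P B) (P X) → IndexAtMost (n * m) (P A) (P X)
  atMost-trans A B X (r , _ , cov) (s , _ , cov′) =
    atMost-by-labels₂ (P A) X (λ j i x → P A (r i ⁻¹ ∙ (s j ⁻¹ ∙ x)))
      (λ x Xx → let (j , p) = cov′ x Xx; (i , q) = cov _ p in j , i , q)
      (λ j i x y _ _ p q →
        resp A (solve 3 (λ s x y → (s ⁻ ⊙ x) ⁻ ⊙ (s ⁻ ⊙ y) ⊜ x ⁻ ⊙ y) refl (s j) x y)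
          (same-coset A (r i) p q))

  -- Induction on the number of subgroups: a subgroup of infinite index is dropped, its cosets being
  -- covered by translates of the others. The translates multiply the cosets, which is why each
  -- subgroup comes with an arbitrary list.
  neumann-cover : ∀ {n} (Z : Subgroup Q) (K : Fin n → Subgroup Q) (reps : Fin n → List (Σ Carrier (P Z))) →
    (∀ z → P Z z → ∃ λ k → Any (λ (g , _) → P (K k) (g ⁻¹ ∙ z)) (reps k)) →
    ∃ λ k → FiniteIndex Q (P (K k)) (P Z)
  neumann-cover {zero}  Z K reps cover with cover ε (ε∈ Z)
  ... | () , _
  neumann-cover {suc n} Z K reps cover with em {FiniteIndex Q (P (K zero)) (P Z)}
  ... | yes fin = zero , fin
  ... | no ¬fin =
    let (k , fin) = neumann-cover Z (K ∘ suc) reps′ cover′ in suc k , fin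
    where
    missed : Σ Carrier λ z₀ → P Z z₀ × ¬ Any (λ (g , _) → P (K zero) (g ⁻¹ ∙ z₀)) (reps zero)
    missed = by-contradiction λ none → ¬fin
      ( length (reps zero) , (λ i → proj₁ (List.lookup (reps zero) i)) , (λ i → proj₂ (List.lookup (reps zero) i))
      , λ z Zz → let hit = by-contradiction λ ¬hit → none (z , Zz , ¬hit)
                 in index hit , lookup-index hit)
    z₀ : Carrier
    z₀ = proj₁ missed
    Zz₀ : P Z z₀
    Zz₀ = proj₁ (proj₂ missed)
    -- The coset z₀ K₀ meets no listed coset of K₀, so g K₀ lies in g z₀⁻¹ times the union of the remaining cosets.
    translate : Σ Carrier (P Z) → Σ Carrier (P Z) → Σ Carrier (P Z)
    translate (g , Zg) (g′ , Zg′) = g ∙ z₀ ⁻¹ ∙ g′ , ∙∈ Z (∙∈ Z Zg (⁻¹∈ Z Zz₀)) Zg′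
    reps′ : Fin n → List (Σ Carrier (P Z))
    reps′ k = reps (suc k) ++ cartesianProductWith translate (reps zero) (reps (suc k))
    Hits : Fin (suc n) → Carrier → Σ Carrier (P Z) → Set
    Hits k z (g , _) = P (K k) (g ⁻¹ ∙ z)
    translated : ∀ z → P Z z → ∀ (gs : List (Σ Carrier (P Z))) → Any (Hits zero z) gs →
                 ∃ λ k → Any (Hits (suc k) z) (cartesianProductWith translate gs (reps (suc k)))
    translated z Zz ((g , Zg) ∷ gs) (there hit) =
      let (k , p) = translated z Zz gs hit
      in k , ++⁺ʳ (List.map (translate (g , Zg)) (reps (suc k))) p
    translated z Zz ((g , Zg) ∷ gs) (here hit) with cover (z₀ ∙ (g ⁻¹ ∙ z)) (∙∈ Z Zz₀ (quotient∈ Z Zg Zz))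
    ... | zero  , p = ⊥-elim (proj₂ (proj₂ missed) (Any.map (λ {x} → untranslate {x}) p))
      where
      untranslate : ∀ {x} → Hits zero (z₀ ∙ (g ⁻¹ ∙ z)) x → Hits zero z₀ x
      untranslate {x , _} q =
        resp (K zero) (solve 4 (λ x z₀ g z → x ⁻ ⊙ (z₀ ⊙ (g ⁻ ⊙ z)) ⊙ (g ⁻ ⊙ z) ⁻ ⊜ x ⁻ ⊙ z₀) refl x z₀ g z)
          (∙∈ (K zero) q (⁻¹∈ (K zero) hit))
    ... | suc k , p = k , ++⁺ˡ (map⁺ (Any.map (λ {x} → retranslate {x}) p))
      where
      retranslate : ∀ {x} → Hits (suc k) (z₀ ∙ (g ⁻¹ ∙ z)) x → Hits (suc k) z (translate (g , Zg) x)
      retranslate {x , _} =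
        resp (K (suc k)) (solve 4 (λ x z₀ g z → x ⁻ ⊙ (z₀ ⊙ (g ⁻ ⊙ z)) ⊜ (g ⊙ z₀ ⁻ ⊙ x) ⁻ ⊙ z) refl x z₀ g z)
    cover′ : ∀ z → P Z z → ∃ λ k → Any (Hits (suc k) z) (reps′ k)
    cover′ z Zz with cover z Zz
    ... | suc k , p = k , ++⁺ˡ p
    ... | zero  , p = let (k , q) = translated z Zz (reps zero) p in k , ++⁺ʳ (reps (suc k)) q

  -- The case of `neumann-cover` in which each subgroup is listed with no coset but itself.
  avoid-infinite-index : ∀ {n} (Z : Subgroup Q) (K : Fin n → Subgroup Q) →
    (∀ k → ¬ FiniteIndex Q (P (K k)) (P Z)) → Σ Carrier λ z → P Z z × ∀ k → ¬ P (K k) z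
  avoid-infinite-index Z K ¬fin = by-contradiction λ none →
    let (k , fin) = neumann-cover Z K (λ _ → (ε , ε∈ Z) ∷ []) λ z Zz →
          let (k , p) = by-contradiction λ ¬k → none (z , Zz , λ k p → ¬k (k , p))
          in k , here (resp (K k) (solve 1 (λ z → z ⊜ e ⁻ ⊙ z) refl z) p)
    in ¬fin k fin

  -- The chain condition and the uniform bounds it gives.

  CentralizerChainCondition : Set
  CentralizerChainCondition = Σ ℕ λ n₀ → Σ ℕ λ d → (g : ℕ → Carrier) (m : ℕ) →
    (∀ i → i < m → IndexAtLeast Q d (λ x → ∀ j → j < suc (suc i) → x commutes g j)
                                    (λ x → ∀ j → j < suc i → x commutes g j)) → m ≤ n₀

  -- d is the constant of the chain condition, so it depends neither on X nor on S.
  module ChainCondition (ccc : CentralizerChainCondition) where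

    n₀ d : ℕ
    n₀ = proj₁ ccc
    d  = proj₁ (proj₂ ccc)

    module _ (X : Subgroup Q) (S : Carrier → Set) where

      MinimalCentralizer : ∀ {m} → Vec Carrier m → Set
      MinimalCentralizer as =
        (∀ i → S (lookup as i)) × (∀ a → S a → ¬ IndexAtLeast Q d (P (C a)) (P (X ⊓ CV as)))

      -- Otherwise every tuple from S has an extension at which the centralizer in X drops by index
      -- at least d, and iteration gives an infinite chain. Elements separated inside `X ⊓ CV as`
      -- are separated inside `CV as`, so the chain condition applies although it does not mention
      -- X.
      minimal-centralizer : Σ ℕ λ m → Σ (Vec Carrier m) MinimalCentralizer
      minimal-centralizer = by-contradiction λ none →
        let next : ∀ {m} (as : Vec Carrier m) → (∀ i → S (lookup as i)) →
                   Σ Carrier λ a → S a × IndexAtLeast Q d (P (C a)) (P (X ⊓ CV as))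
            next as Sas = by-contradiction λ ¬next →
              none (_ , as , Sas , λ a Sa sep → ¬next (a , Sa , sep))
        in contradict next
        where
        contradict : (∀ {m} (as : Vec Carrier m) → (∀ i → S (lookup as i)) →
                      Σ Carrier λ a → S a × IndexAtLeast Q d (P (C a)) (P (X ⊓ CV as))) → ⊥
        -- Step i passes from i+1 to i+2 centralized elements, hence `chain (suc i)`; n₀ + 1 such
        -- steps are one too many.
        contradict next = <-irrefl ≡.refl (proj₂ (proj₂ ccc) g (suc n₀) λ i _ →
            let (f , fX , sep) = proj₂ (proj₂ (next (chain (suc i)) (chain-S (suc i))))
            in f , (λ k → to (suc i) (proj₂ (fX k))) ,
               λ k l k≢l c → sep k l k≢l (c (suc i) ≤-refl))
          where
          chain   : (m : ℕ) → Vec Carrier m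
          chain-S : ∀ m i → S (lookup (chain m) i)
          g : ℕ → Carrier
          chain zero    = []
          chain (suc m) = g m ∷ chain m
          g m = proj₁ (next (chain m) (chain-S m))
          chain-S (suc m) zero    = proj₁ (proj₂ (next (chain m) (chain-S m)))
          chain-S (suc m) (suc i) = chain-S m i
          to : ∀ m {x} → P (CV (chain m)) x → ∀ j → j < m → x commutes g j
          to (suc m) c j (s≤s j≤m) with m≤n⇒m<n∨m≡n j≤m
          ... | inj₁ j<m    = to m (c ∘ suc) j j<m
          ... | inj₂ ≡.refl = c zero

    -- Let S consist of all these x. Its finitely many chosen elements cut out F of some finite
    -- index p in X, and by minimality every x in S costs at most a further factor d inside F.
    finite⇒bounded : (X : Subgroup Q) →
      Σ ℕ λ m → ∀ x → FiniteIndex Q (P (C x)) (P X) → IndexAtMost m (P (C x)) (P X)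
    finite⇒bounded X =
      let S = λ x → FiniteIndex Q (P (C x)) (P X)
          (_ , as , Sas , minimal) = minimal-centralizer X S
          F = X ⊓ CV as
          (p , F≤X) = finite-⊓ X (CV as) X
                        (1 , (λ _ → ε) , (λ _ → ε∈ X) , λ b Xb → zero , quotient∈ X (ε∈ X) Xb)
                        (finite-⋂ (C ∘ lookup as) X Sas)
      in p * d , λ x fin → atMost-trans (C x) F X (¬atLeast⇒atMost (C x) F d (minimal x fin)) F≤X

  -- Conjugation, normalizers and FC-centralizers.

  conj : Carrier → Carrier → Carrier
  conj h x = h ∙ x ∙ h ⁻¹

  conj-commutes : ∀ h {x y} → x commutes y → conj h x commutes conj h y
  conj-commutes h {x} {y} p = begin
    conj h x ∙ conj h y  ≈⟨ solve 3 (λ h x y → h ⊙ x ⊙ h ⁻ ⊙ (h ⊙ y ⊙ h ⁻) ⊜ h ⊙ (x ⊙ y) ⊙ h ⁻) refl h x y ⟩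
    conj h (x ∙ y)       ≈⟨ ∙-congʳ (∙-congˡ p) ⟩
    conj h (y ∙ x)       ≈⟨ solve 3 (λ h x y → h ⊙ (y ⊙ x) ⊙ h ⁻ ⊜ h ⊙ y ⊙ h ⁻ ⊙ (h ⊙ x ⊙ h ⁻)) refl h x y ⟩
    conj h y ∙ conj h x  ∎

  -- Orbit and stabilizer: left cosets of `C t` correspond to conjugates of t, so index bounds for
  -- centralizers count conjugates.
  conj-equal⟺ : ∀ r y t → ((r ⁻¹ ∙ y) commutes t) ⟺ (conj y t ≈ conj r t)
  conj-equal⟺ r y t =
    (λ p → begin
      conj y t                         ≈⟨ solve 3 (λ r y t → y ⊙ t ⊙ y ⁻ ⊜ r ⊙ ((r ⁻ ⊙ y) ⊙ t) ⊙ y ⁻) refl r y t ⟩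
      r ∙ (r ⁻¹ ∙ y ∙ t) ∙ y ⁻¹        ≈⟨ ∙-congʳ (∙-congˡ p) ⟩
      r ∙ (t ∙ (r ⁻¹ ∙ y)) ∙ y ⁻¹      ≈⟨ solve 3 (λ r y t → r ⊙ (t ⊙ (r ⁻ ⊙ y)) ⊙ y ⁻ ⊜ r ⊙ t ⊙ r ⁻) refl r y t ⟩
      conj r t                         ∎) ,
    (λ p → begin
      r ⁻¹ ∙ y ∙ t                     ≈⟨ solve 3 (λ r y t → r ⁻ ⊙ y ⊙ t ⊜ r ⁻ ⊙ (y ⊙ t ⊙ y ⁻) ⊙ y) refl r y t ⟩
      r ⁻¹ ∙ conj y t ∙ y              ≈⟨ ∙-congʳ (∙-congˡ p) ⟩
      r ⁻¹ ∙ conj r t ∙ y              ≈⟨ solve 3 (λ r y t → r ⁻ ⊙ (r ⊙ t ⊙ r ⁻) ⊙ y ⊜ t ⊙ (r ⁻ ⊙ y)) refl r y t ⟩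
      t ∙ (r ⁻¹ ∙ y)                   ∎)

  infix 4 _normalizes_
  -- An equivalence, because conjugation by h may map A properly into itself, and that condition
  -- does not pass to the inverse of h.
  _normalizes_ : Carrier → Subgroup Q → Set
  h normalizes A = ∀ a → P A a ⟺ P A (conj h a)

  normalizes-⁻¹ : ∀ A {h} → h normalizes A → h ⁻¹ normalizes A
  normalizes-⁻¹ A {h} norm a =
    (λ p → proj₂ (norm _) (resp A (solve 2 (λ h a → a ⊜ h ⊙ (h ⁻ ⊙ a ⊙ h ⁻ ⁻) ⊙ h ⁻) refl h a) p)) ,
    (λ p → resp A (solve 2 (λ h a → h ⊙ (h ⁻ ⊙ a ⊙ h ⁻ ⁻) ⊙ h ⁻ ⊜ a) refl h a) (proj₁ (norm _) p))

  -- One inclusion for all h suffices, since the inverse of h normalizes A as well.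
  normalizes-transfer : ∀ A B → (∀ h → h normalizes A → ∀ x → P B x → P B (conj h x)) →
                        ∀ {h} → h normalizes A → h normalizes B
  normalizes-transfer A B forward {h} norm x =
    forward h norm x ,
    λ p → resp B (solve 2 (λ h x → h ⁻ ⊙ (h ⊙ x ⊙ h ⁻) ⊙ h ⁻ ⁻ ⊜ x) refl h x)
            (forward (h ⁻¹) (normalizes-⁻¹ A norm) _ p)

  member-normalizes : ∀ A {h} → P A h → h normalizes A
  member-normalizes A {h} Ah a =
    (λ p → ∙∈ A (∙∈ A Ah p) (⁻¹∈ A Ah)) ,
    (λ p → resp A (solve 2 (λ h a → h ⁻ ⊙ (h ⊙ a ⊙ h ⁻) ⊙ h ⊜ a) refl h a)
             (∙∈ A (∙∈ A (⁻¹∈ A Ah) p) Ah))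

  normalizer : Subgroup Q → Subgroup Q
  normalizer A = record
    { P    = _normalizes A
    ; resp = λ x≈y norm a →
        let xa≈ya = ∙-cong (∙-congʳ x≈y) (⁻¹-cong x≈y)
        in resp A xa≈ya ∘ proj₁ (norm a) , proj₂ (norm a) ∘ resp A (sym xa≈ya)
    ; ε∈   = member-normalizes A (ε∈ A)
    ; ∙∈   = λ {x} {y} norm norm′ a →
        let xya = solve 3 (λ x y a → x ⊙ (y ⊙ a ⊙ y ⁻) ⊙ x ⁻ ⊜ x ⊙ y ⊙ a ⊙ (x ⊙ y) ⁻) refl x y a
        in resp A xya ∘ proj₁ (norm _) ∘ proj₁ (norm′ a) ,
           proj₂ (norm′ a) ∘ proj₂ (norm _) ∘ resp A (sym xya)
    ; ⁻¹∈  = normalizes-⁻¹ A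
    }

  finite-conj : ∀ h x (X X′ : Subgroup Q) → (∀ y → P X′ y → P X (conj (h ⁻¹) y)) →
                FiniteIndex Q (P (C x)) (P X) → FiniteIndex Q (P (C (conj h x))) (P X′)
  finite-conj h x X X′ X′⊆ (m , r , _ , cov) =
    m , atMost-by-labels (P (C (conj h x))) X′ (λ i y → P (C x) (r i ⁻¹ ∙ conj (h ⁻¹) y))
      (λ y X′y → cov _ (X′⊆ y X′y))
      (λ i y z _ _ p q →
        resp (C (conj h x))
          (solve 3 (λ h y z → h ⊙ ((h ⁻ ⊙ y ⊙ h ⁻ ⁻) ⁻ ⊙ (h ⁻ ⊙ z ⊙ h ⁻ ⁻)) ⊙ h ⁻ ⊜ y ⁻ ⊙ z) refl h y z)
          (conj-commutes h (same-coset (C x) (r i) p q)))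

  -- The FC-centralizer of X in the whole group: x need not lie in X, and so `FC E` can contain A.
  FC : Subgroup Q → Subgroup Q
  FC X = record
    { P    = λ x → FiniteIndex Q (P (C x)) (P X)
    ; resp = λ {x} {y} x≈y → finite-mono (P (C x)) (P (C y)) X (λ _ _ → commutes-resp x≈y)
    ; ε∈   = 1 , (λ _ → ε) , (λ _ → ε∈ X) , λ _ _ → zero , commutes-sym (ε∈ (C _))
    ; ∙∈   = λ {x} {y} p q →
        finite-mono (P (C x ⊓ C y)) (P (C (x ∙ y))) X
          (λ b _ (p , q) → commutes-sym (∙∈ (C b) (commutes-sym p) (commutes-sym q)))
          (finite-⊓ (C x) (C y) X p q)
    ; ⁻¹∈  = λ {x} →
        finite-mono (P (C x)) (P (C (x ⁻¹))) X (λ b _ p → commutes-sym (⁻¹∈ (C b) (commutes-sym p)))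
    }

  -- The centralizer in V of the derived subgroup. Centralizing single commutators is enough and is
  -- first-order. Commutators of its own elements are among those it centralizes, so it has class at
  -- most two.
  Metacenter : Subgroup Q → Subgroup Q
  Metacenter V = record
    { P    = λ x → P V x × ∀ y z → P V y → P V z → x commutes [_,_] Q y z
    ; resp = λ x≈y (p , c) → resp V x≈y p , λ y z Vy Vz → resp (C _) x≈y (c y z Vy Vz)
    ; ε∈   = ε∈ V , λ _ _ _ _ → ε∈ (C _)
    ; ∙∈   = λ (p , c) (p′ , c′) → ∙∈ V p p′ , λ y z Vy Vz → ∙∈ (C _) (c y z Vy Vz) (c′ y z Vy Vz)
    ; ⁻¹∈  = λ (p , c) → ⁻¹∈ V p , λ y z Vy Vz → ⁻¹∈ (C _) (c y z Vy Vz)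
    }

  normalizes-Metacenter : ∀ V {h} → h normalizes V → h normalizes Metacenter V
  normalizes-Metacenter V = normalizes-transfer V (Metacenter V) λ h norm x (Vx , c) →
    proj₁ (norm x) Vx , λ y z Vy Vz →
      commutes-resp
        (solve 3 (λ h y z → let y′ = h ⁻ ⊙ y ⊙ h ⁻ ⁻; z′ = h ⁻ ⊙ z ⊙ h ⁻ ⁻
                            in h ⊙ (y′ ⁻ ⊙ z′ ⁻ ⊙ y′ ⊙ z′) ⊙ h ⁻ ⊜ y ⁻ ⊙ z ⁻ ⊙ y ⊙ z) refl h y z)
        (conj-commutes h (c _ _ (proj₁ (normalizes-⁻¹ V norm y) Vy) (proj₁ (normalizes-⁻¹ V norm z) Vz)))

  -- Neumann's argument for bounded conjugacy classes.

  largest : (T : ℕ → Set) → T 0 → ∀ m → ¬ T (suc m) → Σ ℕ λ r → T r × ¬ T (suc r)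
  largest T T0 zero    ¬T = 0 , T0 , ¬T
  largest T T0 (suc m) ¬T with em {T (suc m)}
  ... | yes Tm = suc m , Tm , ¬T
  ... | no ¬Tm = largest T T0 m ¬Tm

  module BoundedClasses (V : Subgroup Q) (m : ℕ)
    (bounded : ∀ v → P V v → IndexAtMost m (P (C v)) (P V)) where

    ClassCentralizer : Carrier → Subgroup Q
    ClassCentralizer t = record
      { P    = λ w → ∀ y → P V y → w commutes conj y t
      ; resp = λ x≈y p y Vy → resp (C _) x≈y (p y Vy)
      ; ε∈   = λ _ _ → ε∈ (C _)
      ; ∙∈   = λ p q y Vy → ∙∈ (C _) (p y Vy) (q y Vy)
      ; ⁻¹∈  = λ p y Vy → ⁻¹∈ (C _) (p y Vy)
      }

    -- Representatives `r i` modulo `C t` yield the whole class of t, so only finitely many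
    -- centralizers are intersected.
    ClassCentralizer-finite : ∀ t → P V t → FiniteIndex Q (P (ClassCentralizer t)) (P V)
    ClassCentralizer-finite t Vt =
      let (r , Vr , cov) = bounded t Vt
      in finite-mono (λ w → ∀ i → P (C (conj (r i) t)) w) (P (ClassCentralizer t)) V
           (λ w _ p y Vy → let (i , q) = cov y Vy
                           in commutes-resp (sym (proj₁ (conj-equal⟺ (r i) y t) q)) (p i))
           (finite-⋂ (λ i → C (conj (r i) t)) V
             (λ i → m , bounded _ (∙∈ V (∙∈ V (Vr i) Vt) (⁻¹∈ V (Vr i)))))

    HasConjugates : ℕ → Set
    HasConjugates r = Σ Carrier λ v → P V v × IndexAtLeast Q r (P (C v)) (P V)

    module LargestClass {r} (v : Carrier) (Vv : P V v) (x : Fin r → Carrier)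
      (x-separated : Separated (P (C v)) (P V) x) (maximal : ¬ HasConjugates (suc r)) where

      conj-shift : ∀ u i → u commutes x i → conj (x i) (u ∙ v) ≈ u ∙ conj (x i) v
      conj-shift u i u-x = begin
        x i ∙ (u ∙ v) ∙ x i ⁻¹    ≈⟨ ∙-congʳ (assoc _ _ _) ⟨
        x i ∙ u ∙ v ∙ x i ⁻¹      ≈⟨ ∙-congʳ (∙-congʳ u-x) ⟨
        u ∙ x i ∙ v ∙ x i ⁻¹      ≈⟨ solve 3 (λ u x v → u ⊙ x ⊙ v ⊙ x ⁻ ⊜ u ⊙ (x ⊙ v ⊙ x ⁻)) refl u (x i) v ⟩
        u ∙ conj (x i) v          ∎

      -- Left multiplication by u turns the distinct conjugates of v into distinct conjugates of u
      -- v.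
      shifted-separated : ∀ u → (∀ i → u commutes x i) → Separated (P (C (u ∙ v))) (P V) x
      shifted-separated u u-x = proj₁ x-separated , λ i j i≢j p →
        proj₂ x-separated i j i≢j (proj₂ (conj-equal⟺ (x i) (x j) v) (∙-cancelˡ u _ _ (begin
          u ∙ conj (x j) v     ≈⟨ conj-shift u j (u-x j) ⟨
          conj (x j) (u ∙ v)   ≈⟨ proj₁ (conj-equal⟺ (x i) (x j) (u ∙ v)) p ⟩
          conj (x i) (u ∙ v)   ≈⟨ conj-shift u i (u-x i) ⟩
          u ∙ conj (x i) v     ∎)))

      -- If u commutes with the conjugators x i, the elements x i (u v) (x i)⁻¹ = u · x i v (x i)⁻¹ are as
      -- many conjugates of u v as the largest class has elements, hence all of them.
      commutator-in-class : ∀ u → P V u → (∀ i → u commutes x i) → ∀ y → P V y →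
        Σ Carrier λ z → P V z × u ⁻¹ ∙ conj y u ≈ conj z v ∙ conj y v ⁻¹
      commutator-in-class u Vu u-x y Vy with covers-or-extends (C (u ∙ v)) V x (shifted-separated u u-x)
      ... | inj₂ more = ⊥-elim (maximal (u ∙ v , ∙∈ V Vu Vv , more))
      ... | inj₁ cov  =
        let (i , p) = cov y Vy
        in x i , proj₁ x-separated i , (begin
          u ⁻¹ ∙ conj y u
            ≈⟨ solve 3 (λ u v y → u ⁻ ⊙ (y ⊙ u ⊙ y ⁻) ⊜ u ⁻ ⊙ (y ⊙ (u ⊙ v) ⊙ y ⁻) ⊙ (y ⊙ v ⊙ y ⁻) ⁻) refl u v y ⟩
          u ⁻¹ ∙ conj y (u ∙ v) ∙ conj y v ⁻¹
            ≈⟨ ∙-congʳ (∙-congˡ (proj₁ (conj-equal⟺ (x i) y (u ∙ v)) p)) ⟩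
          u ⁻¹ ∙ conj (x i) (u ∙ v) ∙ conj y v ⁻¹
            ≈⟨ ∙-congʳ (∙-congˡ (conj-shift u i (u-x i))) ⟩
          u ⁻¹ ∙ (u ∙ conj (x i) v) ∙ conj y v ⁻¹
            ≈⟨ ∙-congʳ (solve 2 (λ u c → u ⁻ ⊙ (u ⊙ c) ⊜ c) refl u (conj (x i) v)) ⟩
          conj (x i) v ∙ conj y v ⁻¹  ∎)

      -- Commutators need not be counted: each is a product of conjugates, and inverses of
      -- conjugates, of v and of representatives `t i` for the centralizer of all `x i`.
      -- Centralizing these finitely many finite classes suffices.
      Metacenter-finite-from : FiniteIndex Q (P (Metacenter V)) (P V)
      Metacenter-finite-from =
        finite-mono (λ w → ∀ i → P (K i) w) (P (Metacenter V)) V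
          (λ w Vw p → Vw , λ y z Vy Vz → central w p y z Vy Vz)
          (finite-⋂ K V λ { zero → ClassCentralizer-finite v Vv ; (suc i) → ClassCentralizer-finite (t i) (Vt i) })
        where
        x-finite : FiniteIndex Q (λ u → ∀ i → P (C (x i)) u) (P V)
        x-finite = finite-⋂ (C ∘ x) V (λ i → m , bounded (x i) (proj₁ x-separated i))
        k = proj₁ x-finite
        t = proj₁ (proj₂ x-finite)
        Vt = proj₁ (proj₂ (proj₂ x-finite))
        K : Fin (suc k) → Subgroup Q
        K zero    = ClassCentralizer v
        K (suc i) = ClassCentralizer (t i)
        central : ∀ w → (∀ i → P (K i) w) → ∀ y z → P V y → P V z → w commutes [_,_] Q y z
        central w p y z Vy Vz =
          -- Write y = t c with t = `t i` and c commuting with every `x i`. Then [tc,z] is [t,z]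
          -- conjugated by the inverse of c, times [c,z]; the first factor involves conjugates of t,
          -- the second conjugates of v.
          let (i , c-x) = proj₂ (proj₂ (proj₂ x-finite)) y Vy
              c = t i ⁻¹ ∙ y
              Vc = quotient∈ V (Vt i) Vy
              (s , Vs , c-eq) = commutator-in-class c Vc c-x (z ⁻¹) (⁻¹∈ V Vz)
              class-v : ∀ {y} → P V y → P (C w) (conj y v)
              class-v Vy = commutes-sym (p zero _ Vy)
              class-t : ∀ {y} → P V y → P (C w) (conj y (t i))
              class-t Vy = commutes-sym (p (suc i) _ Vy)
          in commutes-resp
               (begin
                 conj (c ⁻¹) (t i) ⁻¹ ∙ conj ((z ∙ c) ⁻¹) (t i) ∙ (conj s v ∙ conj (z ⁻¹) v ⁻¹)
                   ≈⟨ ∙-congˡ c-eq ⟨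
                 conj (c ⁻¹) (t i) ⁻¹ ∙ conj ((z ∙ c) ⁻¹) (t i) ∙ (c ⁻¹ ∙ conj (z ⁻¹) c)
                   ≈⟨ solve 3 (λ t y z → let c = t ⁻ ⊙ y in
                        (c ⁻ ⊙ t ⊙ c ⁻ ⁻) ⁻ ⊙ ((z ⊙ c) ⁻ ⊙ t ⊙ (z ⊙ c) ⁻ ⁻) ⊙ (c ⁻ ⊙ (z ⁻ ⊙ c ⊙ z ⁻ ⁻))
                          ⊜ y ⁻ ⊙ z ⁻ ⊙ y ⊙ z) refl (t i) y z ⟩
                 [_,_] Q y z ∎)
               (commutes-sym
                 (∙∈ (C w)
                   (∙∈ (C w) (⁻¹∈ (C w) (class-t (⁻¹∈ V Vc)))
                             (class-t (⁻¹∈ V (∙∈ V Vz Vc))))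
                   (∙∈ (C w) (class-v Vs) (⁻¹∈ (C w) (class-v (⁻¹∈ V Vz))))))

    Metacenter-finite : FiniteIndex Q (P (Metacenter V)) (P V)
    Metacenter-finite =
      let (_ , (v , Vv , x , x-separated) , maximal) =
            largest HasConjugates (ε , ε∈ V , (λ ()) , (λ ()) , λ ()) m
              λ (v , Vv , sep) → atMost⇒¬atLeast (C v) V (bounded v Vv) sep
      in LargestClass.Metacenter-finite-from v Vv x x-separated maximal

  -- First-order definitions of the subgroups.

  open Definability Q

  definable-resp : ∀ {p} {ps : Vec Carrier p} X Y → (∀ x → X x ⟺ Y x) → DefinableFrom ps X → DefinableFrom ps Y
  definable-resp X Y X⟺Y (φ , φ-def) =
    φ , λ x → proj₁ (φ-def x) ∘ proj₂ (X⟺Y x) , proj₁ (X⟺Y x) ∘ proj₂ (φ-def x)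

  definable-⊓ : ∀ {p} {ps : Vec Carrier p} X Y → DefinableFrom ps X → DefinableFrom ps Y →
                DefinableFrom ps (λ x → X x × Y x)
  definable-⊓ X Y (φ , φ-def) (ψ , ψ-def) = and φ ψ , λ x →
    (λ (p , q) → proj₁ (φ-def x) p , proj₁ (ψ-def x) q) ,
    (λ (p , q) → proj₂ (φ-def x) p , proj₂ (ψ-def x) q)

  definable-CV : ∀ {p} (as : Vec Carrier p) → DefinableFrom as (P (CV as))
  definable-CV as =
    (⋀ λ i → eq (mul (var zero) (var (suc i))) (mul (var (suc i)) (var zero))) ,
    λ x → Sat-⋀ _ (x ∷ as)

  -- For a fixed m the representatives can be quantified: some m elements of X, such that every b in
  -- X lies in one of their cosets. This is where uniform bounds are indispensable.
  definable-IndexAtMost : ∀ {p} {ps : Vec Carrier p} m X → DefinableFrom ps X →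
                          DefinableFrom ps (λ x → IndexAtMost m (P (C x)) X)
  definable-IndexAtMost {p} {ps} m X X-def = exs m (and inside covering) , λ x →
      (λ (r , Xr , cov) → proj₁ (Sat-exs m _ (x ∷ ps))
        ( tabulate r
        , proj₁ (Sat-⋀ _ _) (λ i → proj₁ (inside-correct (tabulate r) x i)
            (subst X (≡.sym (lookup∘tabulate r i)) (Xr i)))
        , λ b b∈ → proj₁ (Sat-⋁ _ _)
            (let (i , c) = cov b (proj₂ (member-correct (tabulate r) x b) b∈)
             in i , proj₁ (commute-correct (tabulate r) x b i)
                      (subst (λ y → (y ⁻¹ ∙ b) commutes x) (≡.sym (lookup∘tabulate r i)) c)))) ,
      (λ s →
        let (ys , ins , cov) = proj₂ (Sat-exs m _ (x ∷ ps)) s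
        in lookup ys , (λ i → proj₂ (inside-correct ys x i) (proj₂ (Sat-⋀ _ _) ins i)) ,
           λ b Xb → let (i , c) = proj₂ (Sat-⋁ _ _) (cov b (proj₁ (member-correct ys x b) Xb))
                    in i , proj₂ (commute-correct ys x b i) c)
    where
    yᵢ : Fin m → Fin (m + suc p)
    yᵢ i = i ↑ˡ suc p
    xᵢ : Fin (m + suc p)
    xᵢ = m ↑ʳ zero
    inside-at : Fin m → Formula Q (m + suc p)
    inside-at i = instantiate (proj₁ X-def) (var (yᵢ i)) (λ k → m ↑ʳ suc k)
    inside covering : Formula Q (m + suc p)
    inside = ⋀ inside-at
    member : Formula Q (suc (m + suc p))
    member = instantiate (proj₁ X-def) (var zero) (λ k → suc (m ↑ʳ suc k))
    commute : Fin m → Formula Q (suc (m + suc p))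
    commute i =
      let quot = mul (inv (var (suc (yᵢ i)))) (var zero)
      in eq (mul quot (var (suc xᵢ))) (mul (var (suc xᵢ)) quot)
    covering = all (imp member (⋁ commute))
    module _ (ys : Vec Carrier m) (x : Carrier) where
      agree : ∀ k → lookup ps k ≡ lookup (ys Vec.++ x ∷ ps) (m ↑ʳ suc k)
      agree k = ≡.sym (lookup-++ʳ ys (x ∷ ps) (suc k))
      y≡ : ∀ i → lookup (ys Vec.++ x ∷ ps) (yᵢ i) ≡ lookup ys i
      y≡ = lookup-++ˡ ys (x ∷ ps)
      x≡ : lookup (ys Vec.++ x ∷ ps) xᵢ ≡ x
      x≡ = lookup-++ʳ ys (x ∷ ps) zero
      inside-correct : ∀ i → X (lookup ys i) ⟺ Sat Q (inside-at i) (ys Vec.++ x ∷ ps)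
      inside-correct i =
        let (f , g) = Sat-instantiate X-def (var (yᵢ i)) (λ k → m ↑ʳ suc k) (ys Vec.++ x ∷ ps) agree
        in f ∘ subst X (≡.sym (y≡ i)) , subst X (y≡ i) ∘ g
      member-correct : ∀ b → X b ⟺ Sat Q member (b ∷ (ys Vec.++ x ∷ ps))
      member-correct b =
        Sat-instantiate X-def (var zero) (λ k → suc (m ↑ʳ suc k)) (b ∷ (ys Vec.++ x ∷ ps)) agree
      commute-correct : ∀ b i → ((lookup ys i ⁻¹ ∙ b) commutes x) ⟺ Sat Q (commute i) (b ∷ (ys Vec.++ x ∷ ps))
      commute-correct b i =
        subst₂ (λ y z → (y ⁻¹ ∙ b) commutes z) (≡.sym (y≡ i)) (≡.sym x≡) ,
        subst₂ (λ y z → (y ⁻¹ ∙ b) commutes z) (y≡ i) x≡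

  definable-Metacenter : ∀ {p} {ps : Vec Carrier p} V → DefinableFrom ps (P V) → DefinableFrom ps (P (Metacenter V))
  definable-Metacenter {p} {ps} V V-def =
    and (proj₁ V-def) (all (all (imp y∈ (imp z∈ (eq (mul x [y,z]) (mul [y,z] x)))))) , λ a →
      (λ (Va , c) → proj₁ (proj₂ V-def a) Va ,
        λ b d b∈ d∈ → c b d (proj₂ (y-correct a b d) b∈) (proj₂ (z-correct a b d) d∈)) ,
      (λ (a∈ , c) → proj₂ (proj₂ V-def a) a∈ ,
        λ b d Vb Vd → c b d (proj₁ (y-correct a b d) Vb) (proj₁ (z-correct a b d) Vd))
    where
    x y z [y,z] : Term Q (3 + p)
    x = var (suc (suc zero))
    y = var (suc zero)
    z = var zero
    [y,z] = mul (mul (mul (inv y) (inv z)) y) z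
    y∈ z∈ : Formula Q (3 + p)
    y∈ = instantiate (proj₁ V-def) y (λ k → suc (suc (suc k)))
    z∈ = instantiate (proj₁ V-def) z (λ k → suc (suc (suc k)))
    y-correct : ∀ a b d → P V b ⟺ Sat Q y∈ (d ∷ b ∷ a ∷ ps)
    y-correct a b d = Sat-instantiate V-def y (λ k → suc (suc (suc k))) (d ∷ b ∷ a ∷ ps) (λ _ → ≡.refl)
    z-correct : ∀ a b d → P V d ⟺ Sat Q z∈ (d ∷ b ∷ a ∷ ps)
    z-correct a b d = Sat-instantiate V-def z (λ k → suc (suc (suc k))) (d ∷ b ∷ a ∷ ps) (λ _ → ≡.refl)

  definable-normalizer : ∀ {p} {ps : Vec Carrier p} B → DefinableFrom ps (P B) → DefinableFrom ps (P (normalizer B))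
  definable-normalizer {p} {ps} B B-def = all (and (imp a∈ ʰa∈) (imp ʰa∈ a∈)) , λ h →
      (λ norm a → (λ s → proj₁ (ʰa-correct h a) (proj₁ (norm a) (proj₂ (a-correct h a) s))) ,
                  (λ s → proj₁ (a-correct h a) (proj₂ (norm a) (proj₂ (ʰa-correct h a) s)))) ,
      (λ s a → (λ b → proj₂ (ʰa-correct h a) (proj₁ (s a) (proj₁ (a-correct h a) b))) ,
               (λ b → proj₂ (a-correct h a) (proj₂ (s a) (proj₁ (ʰa-correct h a) b))))
    where
    ʰa : Term Q (2 + p)
    ʰa = mul (mul (var (suc zero)) (var zero)) (inv (var (suc zero)))
    a∈ ʰa∈ : Formula Q (2 + p)
    a∈ = instantiate (proj₁ B-def) (var zero) (λ k → suc (suc k))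
    ʰa∈ = instantiate (proj₁ B-def) ʰa (λ k → suc (suc k))
    a-correct : ∀ h a → P B a ⟺ Sat Q a∈ (a ∷ h ∷ ps)
    a-correct h a = Sat-instantiate B-def (var zero) (λ k → suc (suc k)) (a ∷ h ∷ ps) (λ _ → ≡.refl)
    ʰa-correct : ∀ h a → P B (conj h a) ⟺ Sat Q ʰa∈ (a ∷ h ∷ ps)
    ʰa-correct h a = Sat-instantiate B-def ʰa (λ k → suc (suc k)) (a ∷ h ∷ ps) (λ _ → ≡.refl)

  -- The definable envelope of an almost abelian subgroup.

  whole : Subgroup Q
  whole = record { P = λ _ → ⊤ ; resp = λ _ _ → tt ; ε∈ = tt ; ∙∈ = λ _ _ → tt ; ⁻¹∈ = λ _ → tt }

  finite-self : (A : Subgroup Q) → FiniteIndex Q (P A) (P A)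
  finite-self A = 1 , (λ _ → ε) , (λ _ → ε∈ A) , λ b Ab → zero , quotient∈ A (ε∈ A) Ab

  finite-trans : ∀ A B X → FiniteIndex Q (P A) (P B) → FiniteIndex Q (P B) (P X) → FiniteIndex Q (P A) (P X)
  finite-trans A B X (m , c) (n , c′) = n * m , atMost-trans A B X c c′

  finite-restrict : ∀ A B X → (∀ x → P X x → P B x) → FiniteIndex Q (P A) (P B) → FiniteIndex Q (P A) (P X)
  finite-restrict A B X X⊆B (m , c) = m , atMost-restrict A B X X⊆B c

  module Envelope (ccc : CentralizerChainCondition) (A : Subgroup Q)
    (almost-abelian : ∀ a → P A a → FiniteIndex Q (P (C a)) (P A)) where

    open ChainCondition ccc

    k : ℕ
    k = proj₁ (minimal-centralizer whole (P A))

    as : Vec Carrier k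
    as = proj₁ (proj₂ (minimal-centralizer whole (P A)))

    as∈A : ∀ i → P A (lookup as i)
    as∈A = proj₁ (proj₂ (proj₂ (minimal-centralizer whole (P A))))

    E Z V B : Subgroup Q
    E = CV as
    Z = FC E
    V = Z ⊓ FC Z
    B = Metacenter V

    -- Minimality of `as` bounds the index of `C a` in E by d for every a in A.
    A⊆Z : ∀ a → P A a → P Z a
    A⊆Z a Aa = finite-restrict (C a) (whole ⊓ E) E (λ x Ex → tt , Ex)
      (d , ¬atLeast⇒atMost (C a) (whole ⊓ E) d (proj₂ (proj₂ (proj₂ (minimal-centralizer whole (P A)))) a Aa))

    E-finite-in-A : FiniteIndex Q (P E) (P A)
    E-finite-in-A = finite-⋂ (C ∘ lookup as) A (λ i → almost-abelian _ (as∈A i))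

    Z-bound V-bound : ℕ
    Z-bound = proj₁ (finite⇒bounded E)
    V-bound = proj₁ (finite⇒bounded Z)

    Z-bounded : ∀ z → P Z z → IndexAtMost Z-bound (P (C z)) (P E)
    Z-bounded = proj₂ (finite⇒bounded E)

    -- The bound for conjugates under Z persists under the smaller group V.
    V-bounded : ∀ v → P V v → IndexAtMost V-bound (P (C v)) (P V)
    V-bounded v (_ , Yv) = atMost-restrict (C v) Z V (λ _ → proj₁) (proj₂ (finite⇒bounded Z) v Yv)

    -- Given elements of A ⊓ E in distinct classes modulo FC Z, some z in Z commutes with none of their
    -- quotients, so that E has as many classes modulo C z.
    FC-Z-finite : FiniteIndex Q (P (FC Z)) (P (A ⊓ E))
    FC-Z-finite = suc Z-bound , ¬atLeast⇒atMost (FC Z) (A ⊓ E) (suc Z-bound) λ (f , fAE , sep) →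
      -- Enumerates the ordered pairs of distinct indices: `punchIn i` runs through all indices
      -- other than i.
      let K : Fin (suc Z-bound * Z-bound) → Subgroup Q
          K l = let (i , j) = remQuot {suc Z-bound} Z-bound l in C (f i ⁻¹ ∙ f (punchIn i j))
          (z , Zz , z-avoids) = avoid-infinite-index Z K λ l →
            let (i , j) = remQuot {suc Z-bound} Z-bound l
            in sep i (punchIn i j) (punchInᵢ≢i i j ∘ ≡.sym)
          separated : ∀ i j → i ≢ j → ¬ P (C z) (f i ⁻¹ ∙ f j)
          separated i j i≢j c = z-avoids (combine i (punchOut i≢j))
            (subst (λ (i , j) → P (C (f i ⁻¹ ∙ f (punchIn i j))) z) (≡.sym (remQuot-combine i (punchOut i≢j)))
              (subst (λ j → P (C (f i ⁻¹ ∙ f j)) z) (≡.sym (punchIn-punchOut i≢j)) (commutes-sym c)))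
      in atMost⇒¬atLeast (C z) E (Z-bounded z Zz) (f , (λ i → proj₂ (fAE i)) , separated)

    -- As A lies in Z, its elements in `FC Z` are in V; so `A ⊓ V` has finite index in A, and B has
    -- finite index in V.
    B-finite-in-A : FiniteIndex Q (P B) (P A)
    B-finite-in-A = finite-trans B (A ⊓ V) A
      (finite-restrict B V (A ⊓ V) (λ _ → proj₂) (BoundedClasses.Metacenter-finite V V-bound V-bounded))
      (finite-mono (P (FC Z)) (P (A ⊓ V)) A (λ x Ax Yx → Ax , A⊆Z x Ax , Yx)
        (finite-trans (FC Z) (A ⊓ E) A FC-Z-finite (finite-⊓ A E A (finite-self A) E-finite-in-A)))

    normalizes-B : ∀ {h} → h normalizes A → h normalizes B
    normalizes-B = normalizes-Metacenter V ∘ normalizes-V ∘ normalizes-Z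
      where
      normalizes-Z : ∀ {h} → h normalizes A → h normalizes Z
      normalizes-Z = normalizes-transfer A Z λ h norm x Zx →
        -- The centralizer of `conj h x` is large in the conjugate of E, not yet in E. That
        -- conjugate is cut out by elements `conj h a` of A, and A lies in Z, so it meets E in
        -- finite index.
        let ʰE = CV (map (conj h) as)
            finite = finite-⋂ (λ i → C (lookup (map (conj h) as) i)) E λ i →
              subst (P Z) (≡.sym (lookup-map i (conj h) as)) (A⊆Z _ (proj₁ (norm _) (as∈A i)))
        in finite-trans (C (conj h x)) ʰE E
             (finite-conj h x E ʰE (λ y ʰEy i →
               commutes-resp (solve 2 (λ h a → h ⁻ ⊙ (h ⊙ a ⊙ h ⁻) ⊙ h ⁻ ⁻ ⊜ a) refl h (lookup as i))
                 (conj-commutes (h ⁻¹) (subst (y commutes_) (lookup-map i (conj h) as) (ʰEy i)))) Zx)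
             finite
      normalizes-V : ∀ {h} → h normalizes Z → h normalizes V
      normalizes-V = normalizes-transfer Z V λ h norm x (Zx , Yx) →
        proj₁ (norm x) Zx ,
        finite-conj h x Z Z (λ y → proj₁ (normalizes-⁻¹ Z norm y)) Yx

    B-definable : DefinableFrom as (P B)
    B-definable = definable-Metacenter V
      (definable-⊓ (P Z) (P (FC Z)) Z-definable (FC-definable V-bound Z (proj₂ (finite⇒bounded Z)) Z-definable))
      where
      FC-definable : ∀ m X → (∀ x → P (FC X) x → IndexAtMost m (P (C x)) (P X)) →
                     DefinableFrom as (P X) → DefinableFrom as (P (FC X))
      FC-definable m X bounded X-def = definable-resp (λ x → IndexAtMost m (P (C x)) (P X)) (P (FC X))
        (λ x → (λ c → m , c) , bounded x) (definable-IndexAtMost m (P X) X-def)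
      Z-definable : DefinableFrom as (P Z)
      Z-definable = FC-definable Z-bound E Z-bounded (definable-CV as)

    B-class-two : ∀ x y z → P B x → P B y → P B z → x commutes [_,_] Q y z
    B-class-two x y z (_ , c) (Vy , _) (Vz , _) = c y z Vy Vz

-- K / (K ∩ N) as a group on the elements of K, with equality modulo N and no structure beyond the group.
module Quotient (M : FOGroup) (K N : Subgroup M) (K-normalizes-N : Normalizes M K N) where
  open FOGroup M
  open GroupSolver group using (solve; _⊜_; _⊙_; _⁻; e)

  ≈⇒N : ∀ {x y} → x ≈ y → P N (x ⁻¹ ∙ y)
  ≈⇒N {x} {y} x≈y = resp N (trans (sym (inverseˡ y)) (∙-congʳ (⁻¹-cong (sym x≈y)))) (ε∈ N)

  quotientGroup : Group 0ℓ 0ℓ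
  quotientGroup = record
    { Carrier = Σ Carrier (P K)
    ; _≈_     = λ (x , _) (y , _) → P N (x ⁻¹ ∙ y)
    ; _∙_     = λ (x , Kx) (y , Ky) → x ∙ y , ∙∈ K Kx Ky
    ; ε       = ε , ε∈ K
    ; _⁻¹     = λ (x , Kx) → x ⁻¹ , ⁻¹∈ K Kx
    ; isGroup = record
      { isMonoid = record
        { isSemigroup = record
          { isMagma = record
            { isEquivalence = record
              { refl  = ≈⇒N refl
              ; sym   = λ { {x , _} {y , _} p → resp N (solve 2 (λ x y → (x ⁻ ⊙ y) ⁻ ⊜ y ⁻ ⊙ x) refl x y) (⁻¹∈ N p) }
              ; trans = λ { {x , _} {y , _} {z , _} p q →
                  resp N (solve 3 (λ x y z → x ⁻ ⊙ y ⊙ (y ⁻ ⊙ z) ⊜ x ⁻ ⊙ z) refl x y z) (∙∈ N p q) }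
              }
            ; ∙-cong = λ { {x , _} {x′ , _} {y , Ky} {y′ , _} p q →
                resp N (solve 4 (λ x x′ y y′ → y ⁻ ⊙ (x ⁻ ⊙ x′) ⊙ y ⁻ ⁻ ⊙ (y ⁻ ⊙ y′) ⊜ (x ⊙ y) ⁻ ⊙ (x′ ⊙ y′)) refl x x′ y y′)
                  (∙∈ N (K-normalizes-N _ _ (⁻¹∈ K Ky) p) q) }
            }
          ; assoc = λ _ _ _ → ≈⇒N (assoc _ _ _)
          }
        ; identity = (λ _ → ≈⇒N (identityˡ _)) , (λ _ → ≈⇒N (identityʳ _))
        }
      ; inverse = (λ _ → ≈⇒N (inverseˡ _)) , (λ _ → ≈⇒N (inverseʳ _))
      ; ⁻¹-cong = λ { {x , Kx} {y , _} p →
          resp N (solve 2 (λ x y → x ⊙ (x ⁻ ⊙ y) ⁻ ⊙ x ⁻ ⊜ x ⁻ ⁻ ⊙ y ⁻) refl x y)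
            (K-normalizes-N _ _ Kx (⁻¹∈ N p)) }
      }
    }

  Q : FOGroup
  Q = record
    { group     = quotientGroup
    ; Func      = λ _ → ⊥
    ; Rel       = λ _ → ⊥
    ; funI      = λ ()
    ; relI      = λ ()
    ; funI-cong = λ ()
    ; relI-resp = λ ()
    }

  module Q = FOGroup Q

  ≈ε⟺N : ∀ q → (q Q.≈ Q.ε) ⟺ P N (proj₁ q)
  ≈ε⟺N (x , _) = (λ p → resp N (solve 1 (λ x → (x ⁻ ⊙ e) ⁻ ⊜ x) refl x) (⁻¹∈ N p)) ,
                 (λ p → resp N (solve 1 (λ x → x ⁻ ⊜ x ⁻ ⊙ e) refl x) (⁻¹∈ N p))

  -- The witness `Kx` does not matter: two elements of Q with the same first component are equal
  -- modulo N, and D respects this.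
  preimage : Subgroup Q → Subgroup M
  preimage D = record
    { P    = λ x → Σ (P K x) λ Kx → P D (x , Kx)
    ; resp = λ x≈y (Kx , Dx) → resp K x≈y Kx , resp D (≈⇒N x≈y) Dx
    ; ε∈   = ε∈ K , ε∈ D
    ; ∙∈   = λ (Kx , Dx) (Ky , Dy) → ∙∈ K Kx Ky , ∙∈ D Dx Dy
    ; ⁻¹∈  = λ (Kx , Dx) → ⁻¹∈ K Kx , ⁻¹∈ D Dx
    }

  module _ (K-definable : Definable M (P K)) (N-definable : Definable M (P N)) where
    open Definability M

    private
      k = proj₁ K-definable
      n = proj₁ N-definable
      ks = proj₁ (proj₂ (proj₂ K-definable))
      ns = proj₁ (proj₂ (proj₂ N-definable))

      K-def : DefinableFrom ks (P K)
      K-def = proj₁ (proj₂ K-definable) , proj₂ (proj₂ (proj₂ K-definable))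

      N-def : DefinableFrom ns (P N)
      N-def = proj₁ (proj₂ N-definable) , proj₂ (proj₂ (proj₂ N-definable))

    translateT : ∀ {m} → Term Q m → Term M (m + (k + n))
    translateT (var i)   = var (i ↑ˡ (k + n))
    translateT one       = one
    translateT (mul s t) = mul (translateT s) (translateT t)
    translateT (inv t)   = inv (translateT t)

    kᵢ : ∀ m → Fin k → Fin (m + (k + n))
    kᵢ m i = m ↑ʳ (i ↑ˡ n)

    nᵢ : ∀ m → Fin n → Fin (m + (k + n))
    nᵢ m i = m ↑ʳ (k ↑ʳ i)

    inK : ∀ {m} → Formula M (suc m + (k + n))
    inK {m} = instantiate (proj₁ K-def) (var zero) (kᵢ (suc m))

    -- Interprets the quotient in M: equality becomes membership in N, quantifiers are relativized
    -- to K, and the parameters of K and N stand behind the free variables.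
    translate : ∀ {m} → Formula Q m → Formula M (m + (k + n))
    translate {m} (eq s t) = instantiate (proj₁ N-def) (mul (inv (translateT s)) (translateT t)) (nᵢ m)
    translate fls          = fls
    translate (and φ ψ)    = and (translate φ) (translate ψ)
    translate (or φ ψ)     = or (translate φ) (translate ψ)
    translate (imp φ ψ)    = imp (translate φ) (translate ψ)
    translate {m} (all φ)  = all (imp (inK {m}) (translate φ))
    translate {m} (ex φ)   = ex (and (inK {m}) (translate φ))

    env : ∀ {m} → Vec Q.Carrier m → Vec Carrier (m + (k + n))
    env ρ = map proj₁ ρ Vec.++ (ks Vec.++ ns)

    lookup-kᵢ : ∀ {m} (ρ : Vec Q.Carrier m) i → lookup ks i ≡ lookup (env ρ) (kᵢ m i)
    lookup-kᵢ ρ i =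
      ≡.sym (≡.trans (lookup-++ʳ (map proj₁ ρ) (ks Vec.++ ns) (i ↑ˡ n)) (lookup-++ˡ ks ns i))

    lookup-nᵢ : ∀ {m} (ρ : Vec Q.Carrier m) i → lookup ns i ≡ lookup (env ρ) (nᵢ m i)
    lookup-nᵢ ρ i =
      ≡.sym (≡.trans (lookup-++ʳ (map proj₁ ρ) (ks Vec.++ ns) (k ↑ʳ i)) (lookup-++ʳ ks ns i))

    translateT-correct : ∀ {m} (t : Term Q m) ρ → evalT M (env ρ) (translateT t) ≡ proj₁ (evalT Q ρ t)
    translateT-correct (var i)   ρ =
      ≡.trans (lookup-++ˡ (map proj₁ ρ) (ks Vec.++ ns) i) (lookup-map i proj₁ ρ)
    translateT-correct one       ρ = ≡.refl
    translateT-correct (mul s t) ρ = cong₂ _∙_ (translateT-correct s ρ) (translateT-correct t ρ)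
    translateT-correct (inv t)   ρ = cong _⁻¹ (translateT-correct t ρ)

    inK-correct : ∀ {m} (ρ : Vec Q.Carrier m) a →
                  P K a ⟺ Sat M (inK {m}) (a ∷ env ρ)
    inK-correct {m} ρ a = Sat-instantiate K-def (var zero) (kᵢ (suc m)) (a ∷ env ρ) (lookup-kᵢ ρ)

    translate-correct : ∀ {m} (φ : Formula Q m) ρ → Sat Q φ ρ ⟺ Sat M (translate φ) (env ρ)
    translate-correct {m} (eq s t) ρ =
      let (f , g) = Sat-instantiate N-def (mul (inv (translateT s)) (translateT t)) (nᵢ m) (env ρ) (lookup-nᵢ ρ)
          s≡ = translateT-correct s ρ
          t≡ = translateT-correct t ρ
      in f ∘ subst₂ (λ x y → P N (x ⁻¹ ∙ y)) (≡.sym s≡) (≡.sym t≡) , subst₂ (λ x y → P N (x ⁻¹ ∙ y)) s≡ t≡ ∘ g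
    translate-correct fls       ρ = id , id
    translate-correct (and φ ψ) ρ =
      let (f , f′) = translate-correct φ ρ; (g , g′) = translate-correct ψ ρ
      in (λ (p , q) → f p , g q) , (λ (p , q) → f′ p , g′ q)
    translate-correct (or φ ψ)  ρ =
      let (f , f′) = translate-correct φ ρ; (g , g′) = translate-correct ψ ρ
      in (λ { (inj₁ p) → inj₁ (f p) ; (inj₂ q) → inj₂ (g q) }) ,
         (λ { (inj₁ p) → inj₁ (f′ p) ; (inj₂ q) → inj₂ (g′ q) })
    translate-correct (imp φ ψ) ρ =
      let (f , f′) = translate-correct φ ρ; (g , g′) = translate-correct ψ ρ
      in (λ h → g ∘ h ∘ f′) , (λ h → g′ ∘ h ∘ f)
    translate-correct (all φ)   ρ =
      (λ h a s → let Ka = proj₂ (inK-correct ρ a) s in proj₁ (translate-correct φ ((a , Ka) ∷ ρ)) (h (a , Ka))) ,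
      (λ h (a , Ka) → proj₂ (translate-correct φ ((a , Ka) ∷ ρ)) (h a (proj₁ (inK-correct ρ a) Ka)))
    translate-correct (ex φ)    ρ =
      (λ ((a , Ka) , p) → a , proj₁ (inK-correct ρ a) Ka , proj₁ (translate-correct φ ((a , Ka) ∷ ρ)) p) ,
      (λ (a , s , p) → let Ka = proj₂ (inK-correct ρ a) s
                       in (a , Ka) , proj₂ (translate-correct φ ((a , Ka) ∷ ρ)) p)

    preimage-definable : ∀ D {m} {qs : Vec Q.Carrier m} → Definability.DefinableFrom Q qs (P D) →
                         Definable M (P (preimage D))
    preimage-definable D {m} {qs} (φ , φ-def) =
      m + (k + n) , and (inK {m}) (translate φ) , env qs , λ x →
        (λ (Kx , Dx) → proj₁ (inK-correct qs x) Kx ,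
                       proj₁ (translate-correct φ ((x , Kx) ∷ qs)) (proj₁ (φ-def (x , Kx)) Dx)) ,
        (λ (s , p) → let Kx = proj₂ (inK-correct qs x) s
                     in Kx , proj₂ (φ-def (x , Kx)) (proj₂ (translate-correct φ ((x , Kx) ∷ qs)) p))

  module _ (em : ExcludedMiddle 0ℓ) where
    open GroupTheory em Q using (_commutes_; commutator-ε⟺; CentralizerChainCondition)

    commutes⟺N : ∀ p q → (p commutes q) ⟺ P N ([_,_] M (proj₁ p) (proj₁ q))
    commutes⟺N p q =
      let (f , g) = commutator-ε⟺ p q; (f′ , g′) = ≈ε⟺N ([_,_] Q p q)
      in f′ ∘ g , f ∘ g′

    quotient-chain-condition : Definable M (P K) → Definable M (P N) → M̃c M → CentralizerChainCondition
    quotient-chain-condition K-definable N-definable M-mc =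
      let (n₀ , d , bound) = M-mc K N K-definable N-definable K-normalizes-N
      in n₀ , d , λ g m step → bound (proj₁ ∘ g) (proj₂ ∘ g) m λ i i<m →
           let (f , f-in , sep) = step i i<m
           in proj₁ ∘ f ,
              (λ l → proj₂ (f l) , λ j j< → proj₁ (commutes⟺N (f l) (g j)) (f-in l j j<)) ,
              λ l l′ l≢l′ (_ , c) → sep l l′ l≢l′ λ j j< →
                proj₂ (commutes⟺N ((f l Q.⁻¹) Q.∙ f l′) (g j)) (c j j<)

-- Descending towers with abelian factors that end inside N.

module _ (M : FOGroup) where

  -- D is a parameter because every term has to be normalized by the whole top group, not just by
  -- the term above it.
  data Tower (D N : Subgroup M) : Subgroup M → ℕ → Set₁ where
    bottom : ∀ {X} → (∀ x → P X x → P N x) → Normalizes M D X → Tower D N X 0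
    step   : ∀ {X k} Y → (∀ x → P Y x → P X x) → Normalizes M D X → AbelianFactor M X Y →
             Tower D N Y k → Tower D N X (suc k)

  terms : ∀ {D N X k} → Tower D N X k → ℕ → Subgroup M
  terms {X = X} _                zero    = X
  -- A default value: a series of length k constrains only the terms up to k.
  terms {X = X} (bottom _ _)     (suc i) = X
  terms         (step Y _ _ _ t) (suc i) = terms t i

  terms-last : ∀ {D N X k} (t : Tower D N X k) x → P (terms t k) x → P N x
  terms-last (bottom X⊆N _)   = X⊆N
  terms-last (step _ _ _ _ t) = terms-last t

  terms-step : ∀ {D N X k} (t : Tower D N X k) i → i < k →
    (∀ x → P (terms t (suc i)) x → P (terms t i) x) ×
    Normalizes M D (terms t i) × AbelianFactor M (terms t i) (terms t (suc i))
  terms-step (step Y Y⊆X norm ab (bottom _ _))         zero    _       = Y⊆X , norm , ab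
  terms-step (step Y Y⊆X norm ab (step _ _ _ _ _))     zero    _       = Y⊆X , norm , ab
  terms-step (step Y Y⊆X norm ab t@(bottom _ _))       (suc i) (s≤s i<k) = terms-step t i i<k
  terms-step (step Y Y⊆X norm ab t@(step _ _ _ _ _))   (suc i) (s≤s i<k) = terms-step t i i<k

  tower⇒series : ∀ {D N k} → (∀ x → P N x → FOGroup._≈_ M x (FOGroup.ε M)) →
                 Tower D N D k → Series M (AbelianFactor M) D k
  tower⇒series N-trivial t =
    terms t , (λ x → id , id) , (λ x → N-trivial x ∘ terms-last t x) , terms-step t

-- Induction along the almost abelian series.

module DefinableEnvelope (em : ExcludedMiddle 0ℓ) (M : FOGroup) (M-mc : M̃c M) where
  open FOGroup M
  module GM = GroupTheory em M
  open GM using (_⊓_)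
  open GroupSolver group using (solve; _⊜_; _⊙_; _⁻; e)

  module Step (K N : Subgroup M) (K-definable : Definable M (P K)) (N-definable : Definable M (P N))
    (K-normalizes-N : Normalizes M K N)
    (H A A′ : Subgroup M) (H⊆K : ∀ x → P H x → P K x) (A⊆H : ∀ x → P A x → P H x)
    (A′⊆A : ∀ x → P A′ x → P A x) (H-normalizes-A : Normalizes M H A) (H-normalizes-A′ : Normalizes M H A′)
    (factor : AlmostAbelianFactor M A A′) (A′-finite : FiniteIndex M (P N) (P A′)) where

    open Quotient M K N K-normalizes-N
    module GQ = GroupTheory em Q
    module QS = GroupSolver quotientGroup

    ι : ∀ {a} → P A a → Q.Carrier
    ι {a} Aa = a , H⊆K a (A⊆H a Aa)

    -- The image of A, closed under equality modulo N: an element may have its representative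
    -- outside A.
    Ā : Subgroup Q
    Ā = record
      { P    = λ q → Σ Carrier λ a → Σ (P A a) λ Aa → q Q.≈ ι Aa
      ; resp = λ {p} {q} p≈q (a , Aa , p≈a) → a , Aa , Q.trans {q} {p} {ι Aa} (Q.sym {p} {q} p≈q) p≈a
      ; ε∈   = ε , ε∈ A , ≈⇒N refl
      ; ∙∈   = λ {p} {q} (a , Aa , p≈a) (b , Ab , q≈b) →
          a ∙ b , ∙∈ A Aa Ab , Q.∙-cong {p} {ι Aa} {q} {ι Ab} p≈a q≈b
      ; ⁻¹∈  = λ {p} (a , Aa , p≈a) → a ⁻¹ , ⁻¹∈ A Aa , Q.⁻¹-cong {p} {ι Aa} p≈a
      }

    -- Conjugating [u,a] by `a ∙ u` gives the quotient of the conjugate of a by a, and A′ is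
    -- normalized by H. Thus the commutator condition of the factor speaks about conjugates of a.
    conj-factor : ∀ {u a} → P A u → P A a → P A′ ([_,_] M u a) → P A′ (GM.conj u a ∙ a ⁻¹)
    conj-factor {u} {a} Au Aa p =
      resp A′ (solve 2 (λ u a → a ⊙ u ⊙ (u ⁻ ⊙ a ⁻ ⊙ u ⊙ a) ⊙ (a ⊙ u) ⁻ ⊜ u ⊙ a ⊙ u ⁻ ⊙ a ⁻) refl u a)
        (H-normalizes-A′ (a ∙ u) _ (A⊆H _ (∙∈ A Aa Au)) p)

    -- The conjugates of a are finite in number modulo A′, and A′ is finite modulo N.
    Ā-almost-abelian : ∀ q → P Ā q → FiniteIndex Q (P (GQ.C q)) (P Ā)
    Ā-almost-abelian q (a , Aa , q≈a) =
      let (m , r , Ar , cov) = factor a Aa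
          (n , s , A′s , cov′) = A′-finite
          ā = ι Aa
          r̄ = λ i → ι (Ar i)
          s̄ = λ j → ι (A′⊆A _ (A′s j))
          -- The index i names the coset of b given by the almost abelian factor; with u the
          -- quotient of b by `r i`, the index j names the coset of N containing the element
          -- `conj u a ∙ a ⁻¹` of A′.
          R : Fin m → Fin n → Q.Carrier → Set
          R i j p = Σ Carrier λ b → Σ (P A b) λ Ab →
            (p Q.≈ ι Ab) × (s̄ j Q.≈ (GQ.conj ((r̄ i Q.⁻¹) Q.∙ ι Ab) ā Q.∙ (ā Q.⁻¹)))
      in m * n , GQ.atMost-by-labels₂ (P (GQ.C q)) Ā R
           (λ { p (b , Ab , p≈b) →
             let (i , (Au , A′u)) = cov b Ab
                 (j , Nsu) = cov′ _ (conj-factor Au Aa A′u)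
             in i , j , b , Ab , p≈b , Nsu })
           (λ { i j p p′ _ _ (b , Ab , p≈b , s≈) (b′ , Ab′ , p′≈b′ , s≈′) →
             let u = (r̄ i Q.⁻¹) Q.∙ ι Ab
                 u′ = (r̄ i Q.⁻¹) Q.∙ ι Ab′
                 conj-u′≈conj-u : GQ.conj u′ ā Q.≈ GQ.conj u ā
                 conj-u′≈conj-u = GroupProperties.∙-cancelʳ quotientGroup (ā Q.⁻¹) (GQ.conj u′ ā) (GQ.conj u ā)
                   (Q.trans {GQ.conj u′ ā Q.∙ (ā Q.⁻¹)} {s̄ j} {GQ.conj u ā Q.∙ (ā Q.⁻¹)}
                     (Q.sym {s̄ j} {GQ.conj u′ ā Q.∙ (ā Q.⁻¹)} s≈′) s≈)
                 c : ((u Q.⁻¹) Q.∙ u′) GQ.commutes ā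
                 c = proj₂ (GQ.conj-equal⟺ u u′ ā) conj-u′≈conj-u
                 u⁻¹u′≈p⁻¹p′ : ((u Q.⁻¹) Q.∙ u′) Q.≈ ((p Q.⁻¹) Q.∙ p′)
                 u⁻¹u′≈p⁻¹p′ = Q.trans {(u Q.⁻¹) Q.∙ u′} {(ι Ab Q.⁻¹) Q.∙ ι Ab′} {(p Q.⁻¹) Q.∙ p′}
                   (≈⇒N (solve 3 (λ r b b′ → (r ⁻ ⊙ b) ⁻ ⊙ (r ⁻ ⊙ b′) ⊜ b ⁻ ⊙ b′) refl (r i) b b′))
                   (Q.∙-cong {ι Ab Q.⁻¹} {p Q.⁻¹} {ι Ab′} {p′}
                     (Q.⁻¹-cong {ι Ab} {p} (Q.sym {p} {ι Ab} p≈b)) (Q.sym {p′} {ι Ab′} p′≈b′))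
             in GQ.commutes-resp {x = (p Q.⁻¹) Q.∙ p′} {ā} {q} (Q.sym {q} {ā} q≈a)
                  (resp (GQ.C ā) {(u Q.⁻¹) Q.∙ u′} {(p Q.⁻¹) Q.∙ p′} u⁻¹u′≈p⁻¹p′ c) })

    H-normalizes-Ā : ∀ {h} (Hh : P H h) → (h , H⊆K h Hh) GQ.normalizes Ā
    H-normalizes-Ā {h} Hh q = forward Hh q , λ p →
        resp Ā {GQ.conj (h̄ Q.⁻¹) (GQ.conj h̄ q)} {q}
          (≈⇒N (solve 2 (λ h x → h ⁻ ⊙ (h ⊙ x ⊙ h ⁻) ⊙ h ⁻ ⁻ ⊜ x) refl h (proj₁ q)))
          (forward (⁻¹∈ H Hh) (GQ.conj h̄ q) p)
      where
      h̄ : Q.Carrier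
      h̄ = h , H⊆K h Hh
      forward : ∀ {h} (Hh : P H h) q → P Ā q → P Ā (GQ.conj (h , H⊆K h Hh) q)
      forward {h} Hh q (a , Aa , q≈a) =
        let h̄ = h , H⊆K h Hh
        in GM.conj h a , H-normalizes-A h a Hh Aa ,
           Q.∙-cong {h̄ Q.∙ q} {h̄ Q.∙ ι Aa} {h̄ Q.⁻¹} {h̄ Q.⁻¹}
             (Q.∙-cong {h̄} {h̄} {q} {ι Aa} (Q.refl {h̄}) q≈a) (Q.refl {h̄ Q.⁻¹})

    module Env = GQ.Envelope (quotient-chain-condition em K-definable N-definable M-mc) Ā Ā-almost-abelian

    B K′ : Subgroup M
    B  = preimage Env.B
    K′ = preimage (GQ.normalizer Env.B)

    B-definable : Definable M (P B)
    B-definable = preimage-definable K-definable N-definable Env.B Env.B-definable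

    K′-definable : Definable M (P K′)
    K′-definable = preimage-definable K-definable N-definable (GQ.normalizer Env.B)
      (GQ.definable-normalizer Env.B Env.B-definable)

    K′-normalizes-B : Normalizes M K′ B
    K′-normalizes-B k x (Kk , norm) (Kx , Bx) =
      ∙∈ K (∙∈ K Kk Kx) (⁻¹∈ K Kk) , proj₁ (norm (x , Kx)) Bx

    H⊆K′ : ∀ h → P H h → P K′ h
    H⊆K′ h Hh = H⊆K h Hh , Env.normalizes-B {h , H⊆K h Hh} (H-normalizes-Ā Hh)

    B-finite : FiniteIndex M (P B) (P A)
    B-finite =
      let (m , r , Ār , cov) = Env.B-finite-in-A
      in m , GM.atMost-by-labels (P B) A
           (λ i x → Σ (P K x) λ Kx → P Env.B ((r i Q.⁻¹) Q.∙ (x , Kx)))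
           (λ x Ax → let (i , p) = cov (ι Ax) (x , Ax , ≈⇒N refl) in i , proj₂ (ι Ax) , p)
           (λ { i x y _ _ (Kx , p) (Ky , q) →
             ∙∈ K (⁻¹∈ K Kx) Ky , GQ.same-coset Env.B (r i) {x , Kx} {y , Ky} p q })

    B̄-centre : Subgroup Q
    B̄-centre = record
      { P    = λ q → P Env.B q × ∀ p → P Env.B p → q GQ.commutes p
      ; resp = λ {q} {q′} q≈q′ (Bq , c) → resp Env.B {q} {q′} q≈q′ Bq ,
                 λ p Bp → resp (GQ.C p) {q} {q′} q≈q′ (c p Bp)
      ; ε∈   = ε∈ Env.B , λ p _ → ε∈ (GQ.C p)
      ; ∙∈   = λ {q} {q′} (Bq , c) (Bq′ , c′) → ∙∈ Env.B {q} {q′} Bq Bq′ ,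
                 λ p Bp → ∙∈ (GQ.C p) {q} {q′} (c p Bp) (c′ p Bp)
      ; ⁻¹∈  = λ {q} (Bq , c) → ⁻¹∈ Env.B {q} Bq , λ p Bp → ⁻¹∈ (GQ.C p) {q} (c p Bp)
      }

    centre : Subgroup M
    centre = preimage B̄-centre

    K′-normalizes-centre : Normalizes M K′ centre
    K′-normalizes-centre k x (Kk , norm) (Kx , Bx , c) =
      let k̄ = k , Kk
          x̄ = x , Kx
      in ∙∈ K (∙∈ K Kk Kx) (⁻¹∈ K Kk) , proj₁ (norm x̄) Bx , λ p Bp →
           let p′ = GQ.conj (k̄ Q.⁻¹) p
           in GQ.commutes-resp {x = GQ.conj k̄ x̄} {GQ.conj k̄ p′} {p}
                (≈⇒N (solve 2 (λ k p → k ⊙ (k ⁻ ⊙ p ⊙ k ⁻ ⁻) ⊙ k ⁻ ⊜ p) refl k (proj₁ p)))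
                (GQ.conj-commutes k̄ {x̄} {p′} (c p′ (proj₁ (GQ.normalizes-⁻¹ Env.B {k̄} norm p) Bp)))

    -- Modulo N the group B has class at most two: commutators of X fall into the centre of B modulo
    -- N, and those of the centre fall into N. These are the two abelian factors of one stage;
    -- `D⊆K′` makes D normalize the new terms.
    extend : ∀ D → (∀ x → P D x → P K′ x) → ∀ {X k} → Tower M D B X k → Tower M D N X (suc (suc k))
    extend D D⊆K′ (step Y Y⊆X norm ab t) = step Y Y⊆X norm ab (extend D D⊆K′ t)
    extend D D⊆K′ {X} (bottom X⊆B norm) =
      step (X ⊓ centre) (λ _ → proj₁) norm
        (λ x y Xx Xy →
          let (Kx , Bx) = X⊆B x Xx
              (Ky , By) = X⊆B y Xy
          in GM.commutator∈ X Xx Xy ,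
             GM.commutator∈ K Kx Ky , GQ.commutator∈ Env.B {x , Kx} {y , Ky} Bx By ,
             λ p Bp → GQ.commutes-sym {p} {[_,_] Q (x , Kx) (y , Ky)}
               (Env.B-class-two p (x , Kx) (y , Ky) Bp Bx By))
        (step (X ⊓ N)
          (λ x (Xx , Nx) →
            let Kx = proj₁ (X⊆B x Xx)
            in Xx , Kx , resp B̄-centre {Q.ε} {x , Kx}
                 (Q.sym {x , Kx} {Q.ε} (proj₂ (≈ε⟺N (x , Kx)) Nx)) (ε∈ B̄-centre))
          (λ k x Dk (Xx , Zx) → norm k x Dk Xx , K′-normalizes-centre k x (D⊆K′ k Dk) Zx)
          (λ { x y (Xx , Kx , Bx , c) (Xy , Ky , By , _) → GM.commutator∈ X Xx Xy ,
            proj₁ (commutes⟺N em (x , Kx) (y , Ky)) (c (y , Ky) By) })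
          (bottom (λ _ → proj₂)
            λ k x Dk (Xx , Nx) → norm k x Dk Xx , K-normalizes-N k x (proj₁ (D⊆K′ k Dk)) Nx))

  record EnvelopeModulo (K N H : Subgroup M) (k : ℕ) : Set₁ where
    field
      D         : Subgroup M
      definable : Definable M (P D)
      -- Each enclosing stage needs this to see that D normalizes its own subgroups.
      D⊆K       : ∀ x → P D x → P K x
      tower     : Tower M D N D k
      finite    : FiniteIndex M (λ x → P H x × P D x) (P H)

  -- A stage removes the last factor of S: B replaces N and almost contains `S n`, the normalizer of
  -- B replaces K and still contains H. The length is `n * 2` because `suc n * 2` unfolds to the two
  -- terms added by `extend`.
  envelope : ∀ n (K N : Subgroup M) → Definable M (P K) → Definable M (P N) → Normalizes M K N →
    (H : Subgroup M) → (∀ x → P H x → P K x) →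
    (S : ℕ → Subgroup M) → (∀ x → P (S 0) x ⟺ P H x) → FiniteIndex M (P N) (P (S n)) →
    (∀ i → i ≤ n → Normalizes M H (S i)) →
    (∀ i → i < n → (∀ x → P (S (suc i)) x → P (S i) x) × AlmostAbelianFactor M (S i) (S (suc i))) →
    EnvelopeModulo K N H (n * 2)
  -- Now N almost contains H, and D is the intersection of K and N, as N is not assumed to lie in K.
  envelope zero K N K-def N-def K-norm-N H H⊆K S S₀ (m , r , rS , cov) _ _ = record
    { D         = D
    ; definable = preimage-definable K-def N-def kernel {qs = []}
                    (eq (var zero) one , λ q → proj₂ (≈ε⟺N q) , proj₁ (≈ε⟺N q))
    ; D⊆K       = λ _ → proj₁
    ; tower     = bottom (λ _ → proj₂) λ k x Dk Dx → proj₁ (GM.member-normalizes D Dk x) Dx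
    ; finite    = m , r , (λ i → proj₁ (S₀ (r i)) (rS i)) , λ b Hb →
        let (i , Nrb) = cov b (proj₂ (S₀ b) Hb)
            Hrb = GM.quotient∈ H (proj₁ (S₀ (r i)) (rS i)) Hb
        in i , Hrb , H⊆K _ Hrb , Nrb
    }
    where
    open Quotient M K N K-norm-N
    kernel : Subgroup Q
    kernel = record
      { P    = λ q → P N (proj₁ q)
      ; resp = λ { {x , _} {y , _} x≈y Nx → resp N (solve 2 (λ x y → x ⊙ (x ⁻ ⊙ y) ⊜ y) refl x y) (∙∈ N Nx x≈y) }
      ; ε∈   = ε∈ N
      ; ∙∈   = ∙∈ N
      ; ⁻¹∈  = ⁻¹∈ N
      }
    D : Subgroup M
    D = preimage kernel
  envelope (suc n) K N K-def N-def K-norm-N H H⊆K S S₀ N-finite norm factors =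
    let inner = envelope n St.K′ St.B St.K′-definable St.B-definable St.K′-normalizes-B H St.H⊆K′ S S₀ St.B-finite
                  (λ i i≤n → norm i (m≤n⇒m≤1+n i≤n)) (λ i i<n → factors i (m≤n⇒m≤1+n i<n))
        open EnvelopeModulo inner
    in record
      { D         = D
      ; definable = definable
      ; D⊆K       = λ x Dx → proj₁ (D⊆K x Dx)
      ; tower     = St.extend D D⊆K tower
      ; finite    = finite
      }
    where
    S⊆H : ∀ i → i ≤ suc n → ∀ x → P (S i) x → P H x
    S⊆H zero    _   x = proj₁ (S₀ x)
    S⊆H (suc i) i<n x = S⊆H i (<⇒≤ i<n) x ∘ proj₁ (factors i i<n) x
    module St = Step K N K-def N-def K-norm-N H (S n) (S (suc n)) H⊆K (S⊆H n (m≤n⇒m≤1+n ≤-refl))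
      (proj₁ (factors n ≤-refl)) (norm n (m≤n⇒m≤1+n ≤-refl)) (norm (suc n) ≤-refl)
      (proj₂ (factors n ≤-refl)) N-finite

theorem3p23 : ExcludedMiddle 0ℓ → (M : FOGroup) → M̃c M →
    (H : Subgroup M) → (n : ℕ) → AlmostSolvableClass M H n →
    Σ (Subgroup M) λ D → Definable M (P D) × SolvableClassAtMost M D (2 * n) ×
    FiniteIndex M (λ x → P H x × P D x) (P H)
theorem3p23 em M M-mc H n ((S , S₀ , Sₙ , series) , _) =
    D , definable , (n * 2 , ≤-reflexive (*-comm n 2) , tower⇒series M (λ _ → id) tower) , finite
  where
  open FOGroup M
  open GroupTheory em M using (whole; quotient∈; conj)
  open GroupSolver group using (solve; _⊜_; _⊙_; _⁻; e)
  open SetoidReasoning setoid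

  conj-trivial : ∀ k {x} → x ≈ ε → conj k x ≈ ε
  conj-trivial k x≈ε = trans (∙-congʳ (∙-congˡ x≈ε)) (solve 1 (λ k → k ⊙ e ⊙ k ⁻ ⊜ e) refl k)

  trivial : Subgroup M
  trivial = record
    { P    = _≈ ε
    ; resp = λ x≈y x≈ε → trans (sym x≈y) x≈ε
    ; ε∈   = refl
    ; ∙∈   = λ x≈ε y≈ε → trans (∙-cong x≈ε y≈ε) (identityˡ ε)
    ; ⁻¹∈  = λ x≈ε → trans (⁻¹-cong x≈ε) (solve 0 (e ⁻ ⊜ e) refl)
    }

  -- A series asserts normality only for the terms before n; the last one is trivial.
  S-normal : ∀ i → i ≤ n → Normalizes M H (S i)
  S-normal i i≤n with m≤n⇒m<n∨m≡n i≤n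
  ... | inj₁ i<n    = proj₁ (proj₂ (series i i<n))
  ... | inj₂ ≡.refl = λ k x _ Sx → resp (S i) (sym (conj-trivial k (Sₙ x Sx))) (ε∈ (S i))

  open DefinableEnvelope.EnvelopeModulo
    (DefinableEnvelope.envelope em M M-mc n whole trivial
      (0 , imp fls fls , [] , λ _ → (λ _ → id) , λ _ → tt)
      (0 , eq (var zero) one , [] , λ _ → id , id)
      (λ k _ _ → conj-trivial k)
      H (λ _ _ → tt) S S₀
      (1 , (λ _ → ε) , (λ _ → ε∈ (S n)) , λ b Sb → zero , Sₙ _ (quotient∈ (S n) (ε∈ (S n)) Sb))
      S-normal
      (λ i i<n → proj₁ (series i i<n) , proj₂ (proj₂ (series i i<n))))
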